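{- The set of quasisymmetric functions $\{N_\alpha\}$, as $\alpha$ ranges over all compositions (including the empty composition $\mathbf{0}$), forms a $\mathbb{Z}$-basis for the ring $\mathrm{QSym}$ of quasisymmetric functions with integer coefficients.
   Context: A composition $\alpha=(\alpha_1,\dots,\alpha_m)$ is a finite (possibly empty) sequence of positive integers; $\ell(\alpha)=m$ is its length and $|\alpha|=\alpha_1+\cdots+\alpha_m$ its weight. The empty composition is denoted $\mathbf{0}$. For compositions of the same weight $n$, $\beta$ refines $\alpha$ ($\beta\preccurlyeq\alpha$) if the set of proper partial sums of $\alpha$ (a subset of $\{1,\dots,n-1\}$) is contained in that of $\beta$. $\mathrm{QSym}$ is the ring of quasisymmetric functions in the ordered variables $x_1,x_2,\dots$, with monomial basis $\mathbf{x}^\alpha=\sum_{1\le i_1<\cdots<i_m}x_{i_1}^{\alpha_1}\cdots x_{i_m}^{\alpha_m}$ and fundamental basis $L_\alpha=\sum_{\beta\preccurlyeq\alpha}\mathbf{x}^\beta$ (with $L_{\mathbf 0}=1$). A permutation of a finite set $X$ of positive integers is a sequence $\pi$ listing each element of $X$ exactly once; $C(\pi)$ is the composition whose parts are the lengths of the successive maximal increasing runs of $\pi$. A labeled poset $P$ is a partial order $\le_P$ on a finite set of positive integers (the labels). $\mathcal{L}(P)$ is the set of linear extensions of $P$, i.e. permutations of the label set in which $x$ appears before $y$ whenever $x<_P y$. The quasisymmetric function of $P$ is $F(P)=\sum_{\pi\in\mathcal{L}(P)}L_{C(\pi)}$. $P\oplus Q$ denotes the ordinal sum of posets (all elements of $P$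 lie below all elements of $Q$). For a nonempty composition $\alpha$ with $\ell(\alpha)=m$, let $P_\alpha=A_1\oplus\cdots\oplus A_m$, where $A_i$ is an antichain with $\alpha_i$ elements, labeled by $1,\dots,|\alpha|$ as follows: first the elements of $A_2,A_4,\dots$ are numbered consecutively, followed by the elements of $A_1,A_3,\dots$. Define $N_\alpha=F(P_\alpha)$, and $N_{\mathbf 0}=1$. -}

module Defs where

open import Algebra.Bundles using (CommutativeRing)
open import Algebra.Module.Bundles using (Module)
open import Algebra.Module.Structures using (IsLeftModule)
open import Algebra.Module.Structures.Biased using (module IsModuleFromLeft)
open import Data.Bool.Base using (if_then_else_)
open import Data.Empty using (⊥; ⊥-elim)
open import Data.Integer.Base using (ℤ; 0ℤ; 1ℤ)
import Data.Integer.Base as ℤ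
import Data.Integer.Properties as ℤₚ
open import Data.List.Base
  using (List; []; _∷_; _++_; map; foldr; filter; concatMap; length; applyUpTo)
open import Data.List.NonEmpty.Base using (List⁺; _∷_; [_]; tail)
open import Data.List.Membership.DecPropositional using (_∈?_)
open import Data.List.Membership.Propositional using (_∈_)
open import Data.List.Membership.Propositional.Properties
  using (∈-applyUpTo⁻; ∈-++⁺ˡ; ∈-++⁺ʳ; ∈-++⁻)
open import Data.List.Properties using (≡-dec)
open import Data.List.Relation.Binary.Disjoint.Propositional using (Disjoint)
open import Data.List.Relation.Binary.Sublist.Propositional
  using () renaming (_⊆_ to _⊑_)
open import Data.List.Relation.Binary.Sublist.DecPropositional
  using () renaming (_⊆?_ to sublist?)
open import Data.List.Relation.Binary.Subset.Propositional using (_⊆_)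
open import Data.List.Relation.Binary.Subset.DecPropositional
  using () renaming (_⊆?_ to subset?)
open import Data.List.Relation.Unary.All as All using (All; []; _∷_)
import Data.List.Relation.Unary.All.Properties as Allₚ
open import Data.List.Relation.Unary.AllPairs using (AllPairs; []; _∷_)
open import Data.List.Relation.Unary.Unique.Propositional using (Unique)
import Data.List.Relation.Unary.Unique.Propositional.Properties as Uniqueₚ
open import Data.Nat.Base
  using (ℕ; zero; suc; _+_; _≤_; _<_; _⊔_; NonZero; s≤s)
open import Data.Nat.ListAction using (sum)
open import Data.Nat.Properties
  using (_≟_; _<?_; <⇒≢; +-cancelˡ-≡; suc-injective; m≤m+n; +-monoʳ-<;
         +-assoc; ≤-refl; ≤-trans; ≤-reflexive; <-≤-trans; ≤-<-trans;
         <-irrefl; m≤m⊔n; m≤n⊔m)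
open import Data.Product.Base using (_×_; _,_; ∃; proj₁; proj₂)
open import Data.Sum.Base using (_⊎_; inj₁; inj₂)
open import Data.Vec.Base using (Vec)
open import Data.Vec.Relation.Unary.Linked using (Linked)
open import Function.Base using (_∘_; flip)
open import Level using (Level; 0ℓ) renaming (_⊔_ to _⊔ˡ_)
open import Relation.Binary.Core using (Rel)
open import Relation.Binary.Definitions using (Decidable; DecidableEquality)
open import Relation.Binary.PropositionalEquality
  using (_≡_; _≢_; refl; sym; trans; cong; cong₂)
open import Relation.Nullary.Decidable
  using (Dec; yes; no; map′; _×-dec_; _⊎-dec_; _→-dec_; ¬?; does)

module _ {r ℓr m ℓm i : Level} {R : CommutativeRing r ℓr} (M : Module R m ℓm)
         {I : Set i} (b : I → Module.Carrierᴹ M) where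

  open CommutativeRing R using (Carrier; _≈_; 0#)
  open Module M using (Carrierᴹ; _≈ᴹ_; _+ᴹ_; 0ᴹ; _*ₗ_)

  linearCombination : List (Carrier × I) → Carrierᴹ
  linearCombination = foldr (λ (c , j) v → (c *ₗ b j) +ᴹ v) 0ᴹ

  Spanning : Set _
  Spanning = ∀ v → ∃ λ ts → v ≈ᴹ linearCombination ts

  LinearlyIndependent : Set _
  LinearlyIndependent =
    ∀ ts → Unique (map proj₂ ts) → linearCombination ts ≈ᴹ 0ᴹ →
    All (λ t → proj₁ t ≈ 0#) ts

  record IsBasis : Set (r ⊔ˡ ℓr ⊔ˡ m ⊔ˡ ℓm ⊔ˡ i) where
    field
      spanning            : Spanning
      linearlyIndependent : LinearlyIndependent

infix 9 1+_

record ℕ⁺ : Set where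
  constructor 1+_
  field
    predecessor : ℕ

  value : ℕ
  value = suc predecessor

open ℕ⁺ public using (value)

_≟⁺_ : DecidableEquality ℕ⁺
(1+ a) ≟⁺ (1+ b) = map′ (cong 1+_) (cong ℕ⁺.predecessor) (a ≟ b)

Composition : Set
Composition = List ℕ⁺

_≟ᶜ_ : DecidableEquality Composition
_≟ᶜ_ = ≡-dec _≟⁺_

weight : Composition → ℕ
weight α = sum (map value α)

properPartialSums : Composition → List ℕ
properPartialSums []          = []
properPartialSums (a ∷ [])    = []
properPartialSums (a ∷ b ∷ α) =
  value a ∷ map (value a +_) (properPartialSums (b ∷ α))

infix 4 _≼_ _≼?_

_≼_ : Rel Composition 0ℓ
β ≼ α = weight β ≡ weight α × properPartialSums α ⊆ properPartialSums β

_≼?_ : Decidable _≼_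
β ≼? α = (weight β ≟ weight α)
   ×-dec subset? _≟_ (properPartialSums α) (properPartialSums β)

-- The compositions of k + 1 + n whose first part is at least k + 1.
compositionsFrom : ℕ → ℕ → List Composition
compositionsFrom k zero    = (1+ k ∷ []) ∷ []
compositionsFrom k (suc n) =
  compositionsFrom (suc k) n ++ map (1+ k ∷_) (compositionsFrom 0 n)

compositionsOf : ℕ → List Composition
compositionsOf zero    = [] ∷ []
compositionsOf (suc n) = compositionsFrom 0 n

-- A strictly increasing choice of k of the variables x₁, x₂, …; the
-- number i stands for the variable with index i + 1.
record Variables (k : ℕ) : Set where
  constructor variables
  field
    indices    : Vec ℕ k
    increasing : Linked _<_ indices

-- Every monomial has exactly one form x_{i₁}^{α₁} ⋯ x_{iₘ}^{αₘ} with
-- i₁ < ⋯ < iₘ and all exponents positive; f α i is its coefficient in f.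
PowerSeries : Set
PowerSeries = (α : Composition) → Variables (length α) → ℤ

record QSym : Set where
  field
    coefficient    : PowerSeries
    degreeBound    : ℕ
    bounded        : ∀ α i → degreeBound < weight α → coefficient α i ≡ 0ℤ
    quasisymmetric : ∀ α i j → coefficient α i ≡ coefficient α j

open QSym public

infix 4 _≈_

_≈_ : Rel QSym 0ℓ
f ≈ g = ∀ α i → coefficient f α i ≡ coefficient g α i

infixl 6 _⊞_
infixl 7 _·_

_⊞_ : QSym → QSym → QSym
f ⊞ g = record
  { coefficient    = λ α i → coefficient f α i ℤ.+ coefficient g α i
  ; degreeBound    = degreeBound f ⊔ degreeBound g
  ; bounded        = λ α i d<w → cong₂ ℤ._+_
      (bounded f α i (≤-<-trans (m≤m⊔n _ _) d<w))
      (bounded g α i (≤-<-trans (m≤n⊔m (degreeBound f) _) d<w))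
  ; quasisymmetric = λ α i j →
      cong₂ ℤ._+_ (quasisymmetric f α i j) (quasisymmetric g α i j)
  }

𝟎 : QSym
𝟎 = record
  { coefficient    = λ _ _ → 0ℤ
  ; degreeBound    = 0
  ; bounded        = λ _ _ _ → refl
  ; quasisymmetric = λ _ _ _ → refl
  }

⊟_ : QSym → QSym
⊟ f = record
  { coefficient    = λ α i → ℤ.- coefficient f α i
  ; degreeBound    = degreeBound f
  ; bounded        = λ α i d<w → cong ℤ.-_ (bounded f α i d<w)
  ; quasisymmetric = λ α i j → cong ℤ.-_ (quasisymmetric f α i j)
  }

_·_ : ℤ → QSym → QSym
c · f = record
  { coefficient    = λ α i → c ℤ.* coefficient f α i
  ; degreeBound    = degreeBound f
  ; bounded        = λ α i d<w →
      trans (cong (c ℤ.*_) (bounded f α i d<w)) (ℤₚ.*-zeroʳ c)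
  ; quasisymmetric = λ α i j → cong (c ℤ.*_) (quasisymmetric f α i j)
  }

QSym-isLeftModule : IsLeftModule ℤₚ.+-*-ring _≈_ _⊞_ 𝟎 ⊟_ _·_
QSym-isLeftModule = record
  { isLeftSemimodule = record
    { +ᴹ-isCommutativeMonoid = record
      { isMonoid = record
        { isSemigroup = record
          { isMagma = record
            { isEquivalence = record
              { refl  = λ _ _ → refl
              ; sym   = λ f≈g α i → sym (f≈g α i)
              ; trans = λ f≈g g≈h α i → trans (f≈g α i) (g≈h α i)
              }
            ; ∙-cong = λ f≈g h≈k α i → cong₂ ℤ._+_ (f≈g α i) (h≈k α i)
            }
          ; assoc = λ f g h α i → ℤₚ.+-assoc (coefficient f α i) _ _
          }
        ; identity = (λ f α i → ℤₚ.+-identityˡ _) , (λ f α i → ℤₚ.+-identityʳ _)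
        }
      ; comm = λ f g α i → ℤₚ.+-comm (coefficient f α i) _
      }
    ; isPreleftSemimodule = record
      { *ₗ-cong      = λ c≡d f≈g α i → cong₂ ℤ._*_ c≡d (f≈g α i)
      ; *ₗ-zeroˡ     = λ f α i → refl
      ; *ₗ-distribʳ  = λ f c d α i → ℤₚ.*-distribʳ-+ (coefficient f α i) c d
      ; *ₗ-identityˡ = λ f α i → ℤₚ.*-identityˡ _
      ; *ₗ-assoc     = λ c d f α i → ℤₚ.*-assoc c d _
      ; *ₗ-zeroʳ     = λ c α i → ℤₚ.*-zeroʳ c
      ; *ₗ-distribˡ  = λ c f g α i → ℤₚ.*-distribˡ-+ c _ _
      }
    }
  ; -ᴹ‿cong    = λ f≈g α i → cong ℤ.-_ (f≈g α i)
  ; -ᴹ‿inverse = (λ f α i → ℤₚ.+-inverseˡ (coefficient f α i))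
               , (λ f α i → ℤₚ.+-inverseʳ (coefficient f α i))
  }

QSym-module : Module ℤₚ.+-*-commutativeRing 0ℓ 0ℓ
QSym-module = record
  { Carrierᴹ = QSym
  ; _≈ᴹ_     = _≈_
  ; _+ᴹ_     = _⊞_
  ; _*ₗ_     = _·_
  ; _*ᵣ_     = flip _·_
  ; 0ᴹ       = 𝟎
  ; -ᴹ_      = ⊟_
  ; isModule = IsModuleFromLeft.isModule (record { isLeftModule = QSym-isLeftModule })
  }

∑ : List QSym → QSym
∑ = foldr _⊞_ 𝟎

-- 𝐱^α is the sum of all monomials with exponent sequence α, each taken once.
𝐱^_ : Composition → QSym
𝐱^ α = record
  { coefficient    = λ β _ → indicator β
  ; degreeBound    = weight α
  ; bounded        = λ β _ α<β → indicator-bounded β α<β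
  ; quasisymmetric = λ _ _ _ → refl
  }
  where
  indicator : Composition → ℤ
  indicator β = if does (β ≟ᶜ α) then 1ℤ else 0ℤ

  indicator-bounded : ∀ β → weight α < weight β → indicator β ≡ 0ℤ
  indicator-bounded β α<β with β ≟ᶜ α
  ... | yes refl = ⊥-elim (<-irrefl refl α<β)
  ... | no  _    = refl

𝟏 : QSym
𝟏 = 𝐱^ []

L : Composition → QSym
L α = ∑ (map 𝐱^_ (filter (_≼? α) (compositionsOf (weight α))))

insertions : ℕ → List ℕ → List (List ℕ)
insertions x []       = (x ∷ []) ∷ []
insertions x (y ∷ ys) = (x ∷ y ∷ ys) ∷ map (y ∷_) (insertions x ys)

permutations : List ℕ → List (List ℕ)
permutations []       = [] ∷ []
permutations (x ∷ xs) = concatMap (insertions x) (permutations xs)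

runs : List ℕ → List (List⁺ ℕ)
runs = foldr extend []
  where
  extend : ℕ → List (List⁺ ℕ) → List (List⁺ ℕ)
  extend x []             = [ x ] ∷ []
  extend x ((y ∷ ys) ∷ r) =
    if does (x <? y) then (x ∷ y ∷ ys) ∷ r else [ x ] ∷ (y ∷ ys) ∷ r

C : List ℕ → Composition
C π = map (λ run → 1+ length (tail run)) (runs π)

-- The finite label set is a duplicate-free list, in no particular order;
-- the partial order is a subset of labels × labels.  Decidability is what
-- makes the set of linear extensions a finite list.
record LabeledPoset : Set₁ where
  infix 4 _≤ₚ_ _≤ₚ?_ _<ₚ_ _<ₚ?_
  field
    labels   : List ℕ
    positive : All NonZero labels
    unique   : Unique labels
    _≤ₚ_     : Rel ℕ 0ℓ
    _≤ₚ?_    : Decidable _≤ₚ_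
    ≤ₚ⇒∈     : ∀ {x y} → x ≤ₚ y → x ∈ labels × y ∈ labels
    ≤ₚ-refl    : ∀ {x} → x ∈ labels → x ≤ₚ x
    ≤ₚ-antisym : ∀ {x y} → x ≤ₚ y → y ≤ₚ x → x ≡ y
    ≤ₚ-trans   : ∀ {x y z} → x ≤ₚ y → y ≤ₚ z → x ≤ₚ z

  _<ₚ_ : Rel ℕ 0ℓ
  x <ₚ y = x ≤ₚ y × x ≢ y

  _<ₚ?_ : Decidable _<ₚ_
  x <ₚ? y = (x ≤ₚ? y) ×-dec ¬? (x ≟ y)

open LabeledPoset using (labels)

-- x appears before y in π exactly when x ∷ y ∷ [] is a sublist of π.
Respects : LabeledPoset → List ℕ → Set
Respects P π = ∀ x y → x <ₚ y → (x ∷ y ∷ []) ⊑ π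
  where open LabeledPoset P

respects? : ∀ P π → Dec (Respects P π)
respects? P π = map′ to from
  (All.all? (λ x → All.all? (λ y → (x <ₚ? y) →-dec sublist? _≟_ (x ∷ y ∷ []) π)
                            (labels P))
            (labels P))
  where
  open LabeledPoset P hiding (labels)

  to : All (λ x → All (λ y → x <ₚ y → (x ∷ y ∷ []) ⊑ π) (labels P)) (labels P) →
       Respects P π
  to all x y x<y = All.lookup (All.lookup all (proj₁ (≤ₚ⇒∈ (proj₁ x<y))))
                              (proj₂ (≤ₚ⇒∈ (proj₁ x<y))) x<y

  from : Respects P π →
         All (λ x → All (λ y → x <ₚ y → (x ∷ y ∷ []) ⊑ π) (labels P)) (labels P)
  from r = All.universal (λ x → All.universal (r x) (labels P)) (labels P)

-- permutations lists each permutation of a duplicate-free list exactly once.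
linearExtensions : LabeledPoset → List (List ℕ)
linearExtensions P = filter (respects? P) (permutations (labels P))

F : LabeledPoset → QSym
F P = ∑ (map (L ∘ C) (linearExtensions P))

antichain : (X : List ℕ) → All NonZero X → Unique X → LabeledPoset
antichain X X>0 X! = record
  { labels     = X
  ; positive   = X>0
  ; unique     = X!
  ; _≤ₚ_       = λ x y → x ∈ X × x ≡ y
  ; _≤ₚ?_      = λ x y → _∈?_ _≟_ x X ×-dec (x ≟ y)
  ; ≤ₚ⇒∈       = λ { (x∈X , refl) → x∈X , x∈X }
  ; ≤ₚ-refl    = λ x∈X → x∈X , refl
  ; ≤ₚ-antisym = λ (_ , x≡y) _ → x≡y
  ; ≤ₚ-trans   = λ (x∈X , x≡y) (_ , y≡z) → x∈X , trans x≡y y≡z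
  }

_⟂_ : Rel LabeledPoset 0ℓ
P ⟂ Q = Disjoint (labels P) (labels Q)

ordinalSum : (P Q : LabeledPoset) → P ⟂ Q → LabeledPoset
ordinalSum P Q P⟂Q = record
  { labels     = labels P ++ labels Q
  ; positive   = Allₚ.++⁺ P.positive Q.positive
  ; unique     = Uniqueₚ.++⁺ P.unique Q.unique P⟂Q
  ; _≤ₚ_       = _≤⊕_
  ; _≤ₚ?_      = λ x y → (x P.≤ₚ? y) ⊎-dec (x Q.≤ₚ? y) ⊎-dec
                         (_∈?_ _≟_ x (labels P) ×-dec _∈?_ _≟_ y (labels Q))
  ; ≤ₚ⇒∈       = ≤⊕⇒∈
  ; ≤ₚ-refl    = ≤⊕-refl
  ; ≤ₚ-antisym = ≤⊕-antisym
  ; ≤ₚ-trans   = ≤⊕-trans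
  }
  where
  module P = LabeledPoset P
  module Q = LabeledPoset Q

  _≤⊕_ : Rel ℕ 0ℓ
  x ≤⊕ y = x P.≤ₚ y ⊎ x Q.≤ₚ y ⊎ (x ∈ labels P × y ∈ labels Q)

  ≤⊕⇒∈ : ∀ {x y} → x ≤⊕ y →
         x ∈ labels P ++ labels Q × y ∈ labels P ++ labels Q
  ≤⊕⇒∈ (inj₁ x≤y) with (x∈ , y∈) ← P.≤ₚ⇒∈ x≤y = ∈-++⁺ˡ x∈ , ∈-++⁺ˡ y∈
  ≤⊕⇒∈ (inj₂ (inj₁ x≤y)) with (x∈ , y∈) ← Q.≤ₚ⇒∈ x≤y =
    ∈-++⁺ʳ (labels P) x∈ , ∈-++⁺ʳ (labels P) y∈
  ≤⊕⇒∈ (inj₂ (inj₂ (x∈ , y∈))) = ∈-++⁺ˡ x∈ , ∈-++⁺ʳ (labels P) y∈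

  ≤⊕-refl : ∀ {x} → x ∈ labels P ++ labels Q → x ≤⊕ x
  ≤⊕-refl x∈ with ∈-++⁻ (labels P) x∈
  ... | inj₁ x∈P = inj₁ (P.≤ₚ-refl x∈P)
  ... | inj₂ x∈Q = inj₂ (inj₁ (Q.≤ₚ-refl x∈Q))

  absurd : ∀ {x} {A : Set} → x ∈ labels P → x ∈ labels Q → A
  absurd x∈P x∈Q = ⊥-elim (P⟂Q (x∈P , x∈Q))

  ≤⊕-antisym : ∀ {x y} → x ≤⊕ y → y ≤⊕ x → x ≡ y
  ≤⊕-antisym (inj₁ p) (inj₁ q) = P.≤ₚ-antisym p q
  ≤⊕-antisym (inj₂ (inj₁ p)) (inj₂ (inj₁ q)) = Q.≤ₚ-antisym p q
  ≤⊕-antisym (inj₁ p) (inj₂ (inj₁ q)) =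
    absurd (proj₁ (P.≤ₚ⇒∈ p)) (proj₂ (Q.≤ₚ⇒∈ q))
  ≤⊕-antisym (inj₁ p) (inj₂ (inj₂ (_ , x∈Q))) = absurd (proj₁ (P.≤ₚ⇒∈ p)) x∈Q
  ≤⊕-antisym (inj₂ (inj₁ p)) (inj₁ q) =
    absurd (proj₁ (P.≤ₚ⇒∈ q)) (proj₂ (Q.≤ₚ⇒∈ p))
  ≤⊕-antisym (inj₂ (inj₁ p)) (inj₂ (inj₂ (y∈P , _))) =
    absurd y∈P (proj₂ (Q.≤ₚ⇒∈ p))
  ≤⊕-antisym (inj₂ (inj₂ (_ , y∈Q))) (inj₁ q) = absurd (proj₁ (P.≤ₚ⇒∈ q)) y∈Q
  ≤⊕-antisym (inj₂ (inj₂ (x∈P , _))) (inj₂ (inj₁ q)) =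
    absurd x∈P (proj₂ (Q.≤ₚ⇒∈ q))
  ≤⊕-antisym (inj₂ (inj₂ (x∈P , _))) (inj₂ (inj₂ (_ , x∈Q))) = absurd x∈P x∈Q

  ≤⊕-trans : ∀ {x y z} → x ≤⊕ y → y ≤⊕ z → x ≤⊕ z
  ≤⊕-trans (inj₁ p) (inj₁ q) = inj₁ (P.≤ₚ-trans p q)
  ≤⊕-trans (inj₂ (inj₁ p)) (inj₂ (inj₁ q)) = inj₂ (inj₁ (Q.≤ₚ-trans p q))
  ≤⊕-trans (inj₁ p) (inj₂ (inj₁ q)) =
    absurd (proj₂ (P.≤ₚ⇒∈ p)) (proj₁ (Q.≤ₚ⇒∈ q))
  ≤⊕-trans (inj₁ p) (inj₂ (inj₂ (_ , z∈Q))) =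
    inj₂ (inj₂ (proj₁ (P.≤ₚ⇒∈ p) , z∈Q))
  ≤⊕-trans (inj₂ (inj₁ p)) (inj₁ q) =
    absurd (proj₁ (P.≤ₚ⇒∈ q)) (proj₂ (Q.≤ₚ⇒∈ p))
  ≤⊕-trans (inj₂ (inj₁ p)) (inj₂ (inj₂ (y∈P , _))) =
    absurd y∈P (proj₂ (Q.≤ₚ⇒∈ p))
  ≤⊕-trans (inj₂ (inj₂ (_ , y∈Q))) (inj₁ q) = absurd (proj₁ (P.≤ₚ⇒∈ q)) y∈Q
  ≤⊕-trans (inj₂ (inj₂ (x∈P , _))) (inj₂ (inj₁ q)) =
    inj₂ (inj₂ (x∈P , proj₂ (Q.≤ₚ⇒∈ q)))
  ≤⊕-trans (inj₂ (inj₂ (x∈P , _))) (inj₂ (inj₂ (_ , z∈Q))) =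
    inj₂ (inj₂ (x∈P , z∈Q))

-- P₁ ⊕ ⋯ ⊕ Pₘ, bracketed to the right with the empty poset as last summand.
⨁  : (Ps : List LabeledPoset) → AllPairs _⟂_ Ps → LabeledPoset
⟂-⨁ : ∀ {P Ps} (Ps⟂ : AllPairs _⟂_ Ps) → All (P ⟂_) Ps → P ⟂ ⨁ Ps Ps⟂

⨁ []       []           = antichain [] [] []
⨁ (P ∷ Ps) (P⟂Ps ∷ Ps⟂) = ordinalSum P (⨁ Ps Ps⟂) (⟂-⨁ {P} Ps⟂ P⟂Ps)

⟂-⨁ [] [] (_ , ())
⟂-⨁ {P} {Q ∷ _} (_ ∷ Ps⟂) (P⟂Q ∷ P⟂Ps) (x∈P , x∈) with ∈-++⁻ (labels Q) x∈
... | inj₁ x∈Q  = P⟂Q (x∈P , x∈Q)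
... | inj₂ x∈Qs = ⟂-⨁ {P} Ps⟂ P⟂Ps (x∈P , x∈Qs)

-- The antichain labeled by s + 1, …, s + k.
intervalAntichain : ℕ → ℕ → LabeledPoset
intervalAntichain s k = antichain (applyUpTo (λ i → suc (s + i)) k)
  (Allₚ.applyUpTo⁺₂ _ k (λ _ → _))
  (Uniqueₚ.applyUpTo⁺₁ _ k
    (λ i<j _ eq → <⇒≢ i<j (+-cancelˡ-≡ s _ _ (suc-injective eq))))

-- α₁ + α₃ + ⋯ and α₂ + α₄ + ⋯.
oddWeight evenWeight : Composition → ℕ
oddWeight  []      = 0
oddWeight  (a ∷ α) = value a + evenWeight α
evenWeight []      = 0
evenWeight (a ∷ α) = oddWeight α

-- A₁, …, Aₘ, where A₁, A₃, … take the labels following s and A₂, A₄, …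
-- those following t.
antichains : ℕ → ℕ → Composition → List LabeledPoset
antichains s t []      = []
antichains s t (a ∷ α) =
  intervalAntichain s (value a) ∷ antichains t (s + value a) α

_∈⟨_,_] : ℕ → ℕ → ℕ → Set
x ∈⟨ s , u ] = s < x × x ≤ u

∈-interval : ∀ s k {x} → x ∈ labels (intervalAntichain s k) → x ∈⟨ s , s + k ]
∈-interval s k x∈ with ∈-applyUpTo⁻ _ x∈
... | i , i<k , refl = s≤s (m≤m+n s i) , +-monoʳ-< s i<k

antichains-range : ∀ s t α →
  All (λ A → ∀ x → x ∈ labels A →
       x ∈⟨ s , s + oddWeight α ] ⊎ x ∈⟨ t , t + evenWeight α ])
      (antichains s t α)
antichains-range s t []      = []
antichains-range s t (a ∷ α) =
  (λ _ x∈ → inj₁ (head-range (∈-interval s (value a) x∈))) ∷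
  All.map (λ range x x∈ → tail-range (range x x∈)) (antichains-range t (s + value a) α)
  where
  reassoc : s + value a + evenWeight α ≡ s + (value a + evenWeight α)
  reassoc = +-assoc s (value a) (evenWeight α)

  head-range : ∀ {x} → x ∈⟨ s , s + value a ] → x ∈⟨ s , s + (value a + evenWeight α) ]
  head-range (s<x , x≤) =
    s<x , ≤-trans x≤ (≤-trans (m≤m+n _ (evenWeight α)) (≤-reflexive reassoc))

  tail-range : ∀ {x} →
    x ∈⟨ t , t + oddWeight α ] ⊎ x ∈⟨ s + value a , s + value a + evenWeight α ] →
    x ∈⟨ s , s + (value a + evenWeight α) ] ⊎ x ∈⟨ t , t + oddWeight α ]
  tail-range (inj₁ r)           = inj₂ r
  tail-range (inj₂ (s+a<x , x≤)) =
    inj₁ (≤-<-trans (m≤m+n s _) s+a<x , ≤-trans x≤ (≤-reflexive reassoc))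

Separated : ℕ → ℕ → Composition → Set
Separated s t α = t + evenWeight α ≤ s ⊎ s + oddWeight α ≤ t

antichains-⟂ : ∀ s t α → Separated s t α → AllPairs _⟂_ (antichains s t α)
antichains-⟂ s t []      _   = []
antichains-⟂ s t (a ∷ α) sep =
  All.map (λ {A} → head-⟂ {A}) (antichains-range t (s + value a) α)
  ∷ antichains-⟂ t (s + value a) α (separated-tail sep)
  where
  reassoc : s + value a + evenWeight α ≡ s + (value a + evenWeight α)
  reassoc = +-assoc s (value a) (evenWeight α)

  clash : ∀ {x} → Separated s t (a ∷ α) → x ∈⟨ s , s + value a ] →
          x ∈⟨ t , t + oddWeight α ] ⊎ x ∈⟨ s + value a , s + value a + evenWeight α ] →
          ⊥
  clash _           (_ , x≤)   (inj₂ (<x , _)) = <-irrefl refl (<-≤-trans <x x≤)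
  clash (inj₁ ≤s)   (s<x , _)  (inj₁ (_ , x≤)) =
    <-irrefl refl (<-≤-trans s<x (≤-trans x≤ ≤s))
  clash (inj₂ s+≤t) (_ , x≤)   (inj₁ (t<x , _)) =
    <-irrefl refl (<-≤-trans t<x (≤-trans x≤
      (≤-trans (m≤m+n _ (evenWeight α)) (≤-trans (≤-reflexive reassoc) s+≤t))))

  head-⟂ : ∀ {A} →
    (∀ x → x ∈ labels A →
     x ∈⟨ t , t + oddWeight α ] ⊎ x ∈⟨ s + value a , s + value a + evenWeight α ]) →
    intervalAntichain s (value a) ⟂ A
  head-⟂ range (x∈ , x∈A) = clash sep (∈-interval s (value a) x∈) (range _ x∈A)

  separated-tail : Separated s t (a ∷ α) → Separated t (s + value a) α
  separated-tail (inj₁ ≤s)   = inj₂ (≤-trans ≤s (m≤m+n s _))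
  separated-tail (inj₂ s+≤t) = inj₁ (≤-trans (≤-reflexive reassoc) s+≤t)

-- The labels 1, …, |α|: first on A₂, A₄, …, then on A₁, A₃, ….
𝐏 : Composition → LabeledPoset
𝐏 α = ⨁ (antichains (evenWeight α) 0 α)
        (antichains-⟂ (evenWeight α) 0 α (inj₁ ≤-refl))

N : Composition → QSym
N []      = 𝟏
N (a ∷ α) = F (𝐏 (a ∷ α))

{-# OPTIONS --safe #-}
module Submission where

-- Let the letters a < d of a word record the ascents and descents of a
-- permutation.  In a linear extension of P_α the steps between consecutive
-- antichains are alternately a forced descent and a forced ascent, while the
-- steps inside an antichain are free.  Exactly one linear extension makes
-- every block increasing (odd blocks) or decreasing (even blocks); its word is
-- a^{α₁-1} d^{α₂} a^{α₃} d^{α₄} ⋯.  Any other extension agrees with this word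
-- up to some step inside a block and deviates there, so its word changes
-- letter at a place where the leading word does not.  Hence, if words are
-- compared by the lexicographic order on their sequences of letter changes, α
-- itself encoding the changes of its leading word, N_α is a single L plus L's
-- of strictly larger words.  Since each L_α is likewise 𝐱^α plus monomials of
-- strict refinements, the N_α span; the coordinate functionals of the basis L,
-- obtained by Möbius inversion, give their independence.

open import Defs
open import Data.Bool.Base as Bool using (Bool; true; false; not; _xor_; f≤t; b≤b; f<t)
import Data.Bool.Properties as Boolₚ
open import Data.Empty using (⊥-elim)
open import Data.Integer.Base using (ℤ; 0ℤ; 1ℤ; -1ℤ)
import Data.Integer.Base as ℤ
import Data.Integer.Properties as ℤₚ
open import Data.Integer.Tactic.RingSolver using (solve-∀)
open import Data.List.Base
  using (List; []; _∷_; _++_; map; concatMap; length; upTo; deduplicate; filter;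
         replicate; applyUpTo; reverse)
open import Data.List.Membership.DecPropositional using (_∈?_)
open import Data.List.Membership.Propositional using (_∈_; _∉_; lose; find)
open import Data.List.Membership.Propositional.Properties
  using (∈-concatMap⁺; ∈-concatMap⁻; ∈-upTo⁺; ∈-deduplicate⁺; ∈-filter⁺; ∈-filter⁻;
         ∈-++⁺ˡ; ∈-++⁺ʳ; ∈-++⁻; ∈-map⁺; ∈-map⁻; ∈-∃++)
open import Data.List.NonEmpty.Base using (_∷_)
open import Data.List.Properties
  using (∷-injectiveˡ; ∷-injectiveʳ; map-∘; foldr-map; filter-all; filter-none;
         filter-accept; filter-reject; filter-++; ++-identityʳ; length-++;
         length-replicate; length-applyUpTo; reverse-applyUpTo; ≡-dec)
open import Data.List.Relation.Binary.Permutation.Propositional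
  using (_↭_; ↭⇒↭ₛ; prep; swap; ↭-refl; ↭-sym; ↭-trans)
open import Data.List.Relation.Binary.Permutation.Propositional.Properties
  using (∈-resp-↭; filter-↭; drop-mid; ↭-empty-inv; ↭-length; ↭-reverse)
  renaming (++⁺ to ↭-++⁺)
open import Data.List.Relation.Binary.Permutation.Setoid.Properties using (Unique-resp-↭)
open import Data.List.Relation.Binary.Pointwise using (Pointwise-≡⇒≡)
open import Data.List.Relation.Binary.Pointwise.Base using (Pointwise; []; _∷_)
import Data.List.Relation.Binary.Pointwise.Properties as Pointwiseₚ
open import Data.List.Relation.Binary.Sublist.Propositional
  using ([]; _∷_; _∷ʳ_; from∈) renaming (_⊆_ to _⊑_; lookup to ⊑-lookup)
import Data.List.Relation.Binary.Sublist.Propositional.Properties as Sublistₚ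
open import Data.List.Relation.Binary.Subset.Propositional using (_⊆_)
open import Data.List.Relation.Unary.All as All using (All; []; _∷_)
import Data.List.Relation.Unary.All.Properties as Allₚ
open import Data.List.Relation.Unary.AllPairs using (AllPairs; []; _∷_)
import Data.List.Relation.Unary.AllPairs.Properties as AllPairsₚ
open import Data.List.Relation.Unary.Any using (here; there)
open import Data.List.Relation.Unary.Linked as Linked using (Linked; []; [-]; _∷_)
import Data.List.Relation.Unary.Linked.Properties as Linkedₚ
open import Data.List.Relation.Unary.Sorted.TotalOrder.Properties using (↗↭↗⇒≋)
open import Data.List.Relation.Unary.Unique.DecPropositional.Properties _≟ᶜ_
  using (deduplicate-!)
open import Data.List.Relation.Unary.Unique.Propositional using (Unique)
import Data.List.Relation.Unary.Unique.Propositional.Properties as Uniqueₚ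
open import Data.Nat.Base as ℕ using (ℕ; zero; suc; _≤_; _<_; s≤s; z≤n)
import Data.Nat.Properties as ℕₚ
open import Data.Product.Base using (_×_; _,_; ∃; proj₁; proj₂)
open import Data.Sum.Base using (_⊎_; inj₁; inj₂)
open import Data.Vec.Base using (Vec; []; _∷_)
open import Data.Vec.Relation.Unary.Linked
  using ([]; [-]; _∷_) renaming (Linked to Linkedᵛ)
open import Function.Base using (_∘_; id; flip; _on_)
open import Induction.WellFounded using (Acc; acc; WellFounded; module Subrelation)
open import Level using (0ℓ)
import Relation.Binary.Construct.Flip.EqAndOrd as Flip
import Relation.Binary.Construct.On as On
open import Relation.Binary.Core using (Rel)
import Relation.Binary.Definitions as Binary
open import Relation.Binary.PropositionalEquality
  using (_≡_; _≢_; refl; sym; trans; cong; cong₂; subst; setoid)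
open import Relation.Nullary.Decidable
  using (yes; no; does; ¬?; map′; dec-true; dec-false)
open import Relation.Nullary.Negation using (¬_)
open import Relation.Unary using (Pred; Decidable)

-- Submodules of QSym and the monomial expansion

-- The lemmas on sums below are applied to two kinds of submodule: to spans, for generation, and to
-- kernels of functionals, where they become `∑-vanish` and `∑-single`.
record Submodule : Set₁ where
  field
    Contains : QSym → Set
    resp     : ∀ {f g} → f ≈ g → Contains f → Contains g
    𝟎-closed : Contains 𝟎
    ⊞-closed : ∀ {f g} → Contains f → Contains g → Contains (f ⊞ g)
    ·-closed : ∀ c {f} → Contains f → Contains (c · f)

  ⊟-closed : ∀ {f} → Contains f → Contains (⊟ f)
  ⊟-closed f∈ = resp (λ _ _ → ℤₚ.-1*i≡-i _) (·-closed -1ℤ f∈)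

  ∑-closed : ∀ {A : Set} (f : A → QSym) xs →
             (∀ {x} → x ∈ xs → Contains (f x)) → Contains (∑ (map f xs))
  ∑-closed f []       h = 𝟎-closed
  ∑-closed f (x ∷ xs) h = ⊞-closed (h (here refl)) (∑-closed f xs (h ∘ there))

  -- The terms are told apart by a key `g`, mostly `id`. In a linear combination only the indices
  -- are known to be distinct, and there `g` is the index of a term.
  ∑-isolate : ∀ {A B : Set} (f : A → QSym) (g : A → B) {x xs} →
              x ∈ xs → AllPairs (_≢_ on g) xs →
              (∀ {y} → y ∈ xs → g y ≢ g x → Contains (f y)) →
              Contains (∑ (map f xs) ⊞ ⊟ f x)
  ∑-isolate f g {x} {_ ∷ xs} (here refl) (x∉ ∷ _) h =
    resp (λ α i → sym (cancel (coefficient (f x) α i) _))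
         (∑-closed f xs λ y∈ → h (there y∈) (All.lookup x∉ y∈ ∘ sym))
    where
    cancel : ∀ a b → (a ℤ.+ b) ℤ.+ ℤ.- a ≡ b
    cancel = solve-∀
  ∑-isolate f g {x} {y ∷ _} (there x∈) (y∉ ∷ u) h =
    resp (λ α i → sym (ℤₚ.+-assoc (coefficient (f y) α i) _ _))
         (⊞-closed (h (here refl) (All.lookup y∉ x∈))
                   (∑-isolate f g x∈ u (h ∘ there)))

  -- The step of unitriangular inversion, used once to pass from N to L and once to pass from L to
  -- 𝐱.
  ∑-extract : ∀ {A B : Set} (f : A → QSym) (g : A → B) {x xs} →
              x ∈ xs → AllPairs (_≢_ on g) xs →
              (∀ {y} → y ∈ xs → g y ≢ g x → Contains (f y)) →
              Contains (∑ (map f xs)) → Contains (f x)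
  ∑-extract f g {x} {xs} x∈ u h ∑∈ =
    resp (λ α i → cancel (coefficient (∑ (map f xs)) α i) (coefficient (f x) α i))
         (⊞-closed ∑∈ (⊟-closed (∑-isolate f g x∈ u h)))
    where
    cancel : ∀ a b → a ℤ.+ ℤ.- (a ℤ.+ ℤ.- b) ≡ b
    cancel = solve-∀

record Functional : Set where
  field
    apply  : QSym → ℤ
    ≈-cong : ∀ {f g} → f ≈ g → apply f ≡ apply g
    ⊞-homo : ∀ f g → apply (f ⊞ g) ≡ apply f ℤ.+ apply g
    ·-homo : ∀ c f → apply (c · f) ≡ c ℤ.* apply f

  𝟎-homo : apply 𝟎 ≡ 0ℤ
  𝟎-homo = trans (≈-cong (λ _ _ → refl)) (·-homo 0ℤ 𝟎)

  ⊟-homo : ∀ f → apply (⊟ f) ≡ ℤ.- apply f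
  ⊟-homo f = trans (≈-cong λ _ _ → sym (ℤₚ.-1*i≡-i _))
                   (trans (·-homo -1ℤ f) (ℤₚ.-1*i≡-i _))

  kernel : Submodule
  kernel = record
    { Contains = λ f → apply f ≡ 0ℤ
    ; resp     = λ f≈g → trans (sym (≈-cong f≈g))
    ; 𝟎-closed = 𝟎-homo
    ; ⊞-closed = λ p q → trans (⊞-homo _ _) (cong₂ ℤ._+_ p q)
    ; ·-closed = λ c p → trans (·-homo c _) (trans (cong (c ℤ.*_) p) (ℤₚ.*-zeroʳ c))
    }

  open Submodule kernel public using () renaming (∑-closed to ∑-vanish)

  ∑-single : ∀ {A B : Set} (f : A → QSym) (g : A → B) {x xs} →
             x ∈ xs → AllPairs (_≢_ on g) xs →
             (∀ {y} → y ∈ xs → g y ≢ g x → apply (f y) ≡ 0ℤ) →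
             apply (∑ (map f xs)) ≡ apply (f x)
  ∑-single f g {x} {xs} x∈ u h = ℤₚ.i-j≡0⇒i≡j _ _
    (trans (cong (λ z → apply (∑ (map f xs)) ℤ.+ z) (sym (⊟-homo (f x))))
    (trans (sym (⊞-homo (∑ (map f xs)) (⊟ f x)))
           (Submodule.∑-isolate kernel f g x∈ u h)))

open Functional using (apply)

coefficientAt : ∀ α → Variables (length α) → Functional
coefficientAt α i = record
  { apply  = λ f → coefficient f α i
  ; ≈-cong = λ f≈g → f≈g α i
  ; ⊞-homo = λ _ _ → refl
  ; ·-homo = λ _ _ → refl
  }

infixl 6 _⊖_

_⊖_ : Functional → Functional → Functional
Φ ⊖ Ψ = record
  { apply  = λ f → Φ.apply f ℤ.- Ψ.apply f
  ; ≈-cong = λ f≈g → cong₂ ℤ._-_ (Φ.≈-cong f≈g) (Ψ.≈-cong f≈g)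
  ; ⊞-homo = λ f g → trans (cong₂ ℤ._-_ (Φ.⊞-homo f g) (Ψ.⊞-homo f g))
                           (interchange (Φ.apply f) _ _ _)
  ; ·-homo = λ c f → trans (cong₂ ℤ._-_ (Φ.·-homo c f) (Ψ.·-homo c f))
                           (factor c (Φ.apply f) _)
  }
  where
  module Φ = Functional Φ
  module Ψ = Functional Ψ
  interchange : ∀ a b c d → (a ℤ.+ b) ℤ.- (c ℤ.+ d) ≡ (a ℤ.- c) ℤ.+ (b ℤ.- d)
  interchange = solve-∀
  factor : ∀ c a b → c ℤ.* a ℤ.- c ℤ.* b ≡ c ℤ.* (a ℤ.- b)
  factor = solve-∀

-- The choice x₁, ..., xₙ. By quasisymmetry a coefficient depends on the exponents alone, so one
-- choice suffices to read it off.
firstVariables : ∀ n → Variables n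
firstVariables n = variables (from 0 n) (inc 0 n)
  where
  from : ℕ → ∀ n → Vec ℕ n
  from k zero    = []
  from k (suc n) = k ∷ from (suc k) n
  inc : ∀ k n → Linkedᵛ _<_ (from k n)
  inc k zero          = []
  inc k (suc zero)    = [-]
  inc k (suc (suc n)) = ℕₚ.n<1+n k ∷ inc (suc k) (suc n)

∈-compositionsFrom : ∀ k n a α → k ≤ a → suc a ℕ.+ weight α ≡ suc k ℕ.+ n →
                     (1+ a ∷ α) ∈ compositionsFrom k n
∈-compositionsFrom k n a α k≤a e with k ℕₚ.≟ a
∈-compositionsFrom k zero k [] k≤a e | yes refl = here refl
∈-compositionsFrom k zero k (_ ∷ _) k≤a e | yes refl with () ← ℕₚ.+-cancelˡ-≡ (suc k) _ _ e
∈-compositionsFrom k (suc n) k [] k≤a e | yes refl with () ← ℕₚ.+-cancelˡ-≡ (suc k) 0 _ e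
∈-compositionsFrom k (suc n) k (1+ b ∷ β) k≤a e | yes refl =
  ∈-++⁺ʳ (compositionsFrom (suc k) n) (∈-map⁺ _
    (∈-compositionsFrom 0 n b β z≤n (ℕₚ.+-cancelˡ-≡ (suc k) _ _ e)))
∈-compositionsFrom k zero a α k≤a e | no k≢a =
  -- The first part alone would exceed the whole weight k + 1.
  ⊥-elim (ℕₚ.<-irrefl (sym (trans e (ℕₚ.+-identityʳ (suc k))))
    (ℕₚ.≤-trans (s≤s (ℕₚ.≤∧≢⇒< k≤a k≢a)) (ℕₚ.m≤m+n (suc a) _)))
∈-compositionsFrom k (suc n) a α k≤a e | no k≢a =
  ∈-++⁺ˡ (∈-compositionsFrom (suc k) n a α (ℕₚ.≤∧≢⇒< k≤a k≢a)
    (trans e (cong suc (ℕₚ.+-suc k n))))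

-- Separates the two lists appended in `compositionsFrom k (suc n)`: first parts are at least k + 2
-- in one and equal to k + 1 in the other.
compositionsFrom-head : ∀ k n {α} → α ∈ compositionsFrom k n →
                        ∃ λ a → ∃ λ β → α ≡ 1+ a ∷ β × k ≤ a
compositionsFrom-head k zero (here refl) = k , [] , refl , ℕₚ.≤-refl
compositionsFrom-head k (suc n) α∈
  with ∈-++⁻ (compositionsFrom (suc k) n) α∈
... | inj₁ α∈ˡ with a , β , refl , k<a ← compositionsFrom-head (suc k) n α∈ˡ =
      a , β , refl , ℕₚ.<⇒≤ k<a
... | inj₂ α∈ʳ with β , _ , refl ← ∈-map⁻ _ α∈ʳ = k , β , refl , ℕₚ.≤-refl

compositionsFrom-unique : ∀ k n → Unique (compositionsFrom k n)
compositionsFrom-unique k zero    = [] ∷ []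
compositionsFrom-unique k (suc n) =
  Uniqueₚ.++⁺ (compositionsFrom-unique (suc k) n)
              (Uniqueₚ.map⁺ (λ { refl → refl }) (compositionsFrom-unique 0 n))
              disjoint
  where
  disjoint : ∀ {α} → ¬ (α ∈ compositionsFrom (suc k) n ×
                        α ∈ map (1+ k ∷_) (compositionsFrom 0 n))
  disjoint (α∈ˡ , α∈ʳ)
    with a , β , refl , k<a ← compositionsFrom-head (suc k) n α∈ˡ
    with _ , _ , refl ← ∈-map⁻ _ α∈ʳ = ℕₚ.<-irrefl refl k<a

∈-compositionsOf : ∀ α → α ∈ compositionsOf (weight α)
∈-compositionsOf []         = here refl
∈-compositionsOf (1+ a ∷ α) = ∈-compositionsFrom 0 _ a α z≤n refl

compositionsOf-unique : ∀ n → Unique (compositionsOf n)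
compositionsOf-unique zero    = [] ∷ []
compositionsOf-unique (suc n) = compositionsFrom-unique 0 n

𝐱-coefficient-self : ∀ α i → coefficient (𝐱^ α) α i ≡ 1ℤ
𝐱-coefficient-self α i rewrite dec-true (α ≟ᶜ α) refl = refl

𝐱-coefficient-other : ∀ α β i → α ≢ β → coefficient (𝐱^ α) β i ≡ 0ℤ
𝐱-coefficient-other α β i α≢β rewrite dec-false (β ≟ᶜ α) (α≢β ∘ sym) = refl

≼-refl : ∀ {α} → α ≼ α
≼-refl = refl , id

refinements : Composition → List Composition
refinements α = filter (_≼? α) (compositionsOf (weight α))

refinements-unique : ∀ α → Unique (refinements α)
refinements-unique α = Uniqueₚ.filter⁺ (_≼? α) (compositionsOf-unique (weight α))

∈-refinements⁺ : ∀ {α β} → β ≼ α → β ∈ refinements α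
∈-refinements⁺ {α} {β} β≼α = ∈-filter⁺ (_≼? α)
  (subst (λ n → β ∈ compositionsOf n) (proj₁ β≼α) (∈-compositionsOf β)) β≼α

∈-refinements⁻ : ∀ {α β} → β ∈ refinements α → β ≼ α
∈-refinements⁻ {α} β∈ = proj₂ (∈-filter⁻ (_≼? α) {xs = compositionsOf (weight α)} β∈)

L-coefficient-≼ : ∀ α β i → β ≼ α → coefficient (L α) β i ≡ 1ℤ
L-coefficient-≼ α β i β≼α = trans
  (Functional.∑-single (coefficientAt β i) 𝐱^_ id (∈-refinements⁺ β≼α) (refinements-unique α)
    (λ {γ} _ γ≢β → 𝐱-coefficient-other γ β i γ≢β))
  (𝐱-coefficient-self β i)

L-coefficient-⋠ : ∀ α β i → ¬ β ≼ α → coefficient (L α) β i ≡ 0ℤ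
L-coefficient-⋠ α β i β⋠α = Functional.∑-vanish (coefficientAt β i) 𝐱^_ (refinements α)
  (λ {γ} γ∈ → 𝐱-coefficient-other γ β i λ { refl → β⋠α (∈-refinements⁻ γ∈) })

module _ (S : Submodule) where
  open Submodule S

  -- The degree bound makes the monomial expansion finite: f is the sum of its coefficients times
  -- the 𝐱^α with α of weight at most `degreeBound f`.
  monomials⊆⇒all : (∀ α → Contains (𝐱^ α)) → ∀ f → Contains f
  monomials⊆⇒all 𝐱∈S f = resp expansion
    (∑-closed term support λ {α} _ → ·-closed (coef α) (𝐱∈S α))
    where
    coef : Composition → ℤ
    coef α = coefficient f α (firstVariables (length α))

    term : Composition → QSym
    term α = coef α · 𝐱^ α

    -- `deduplicate` yields distinctness at once, without comparing compositions of different
    -- weights.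
    support : List Composition
    support = deduplicate _≟ᶜ_ (concatMap compositionsOf (upTo (suc (degreeBound f))))

    expansion : ∑ (map term support) ≈ f
    expansion β i with weight β ℕₚ.≤? degreeBound f
    ... | yes w≤d = trans
      (Functional.∑-single (coefficientAt β i) term id
        (∈-deduplicate⁺ _≟ᶜ_ (∈-concatMap⁺ compositionsOf
          (lose (∈-upTo⁺ (s≤s w≤d)) (∈-compositionsOf β))))
        (deduplicate-! (concatMap compositionsOf (upTo (suc (degreeBound f))))) other)
      (trans (cong (coef β ℤ.*_) (𝐱-coefficient-self β i))
        (trans (ℤₚ.*-identityʳ _) (quasisymmetric f β _ i)))
      where
      other : ∀ {γ} → γ ∈ support → γ ≢ β → coefficient (term γ) β i ≡ 0ℤ
      other {γ} _ γ≢β = trans (cong (coef γ ℤ.*_) (𝐱-coefficient-other γ β i γ≢β))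
                              (ℤₚ.*-zeroʳ (coef γ))
    ... | no w≰d = trans
      (Functional.∑-vanish (coefficientAt β i) term support λ {γ} _ → vanish γ)
      (sym (bounded f β i (ℕₚ.≰⇒> w≰d)))
      where
      vanish : ∀ γ → coefficient (term γ) β i ≡ 0ℤ
      vanish γ with γ ≟ᶜ β
      ... | yes refl = cong (ℤ._* coefficient (𝐱^ γ) γ i) (bounded f γ _ (ℕₚ.≰⇒> w≰d))
      ... | no γ≢β = trans (cong (coef γ ℤ.*_) (𝐱-coefficient-other γ β i γ≢β))
                              (ℤₚ.*-zeroʳ (coef γ))

-- Linear extensions of an ordinal sum

insertions⇒↭ : ∀ x ys {zs} → zs ∈ insertions x ys → zs ↭ x ∷ ys
insertions⇒↭ x []       (here refl) = ↭-refl
insertions⇒↭ x (y ∷ ys) (here refl) = ↭-refl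
insertions⇒↭ x (y ∷ ys) (there zs∈)
  with _ , zs∈′ , refl ← ∈-map⁻ _ zs∈ =
  ↭-trans (prep y (insertions⇒↭ x ys zs∈′)) (swap y x ↭-refl)

∈-insertions : ∀ x ys zs → ys ++ x ∷ zs ∈ insertions x (ys ++ zs)
∈-insertions x []       []       = here refl
∈-insertions x []       (z ∷ zs) = here refl
∈-insertions x (y ∷ ys) zs       = there (∈-map⁺ _ (∈-insertions x ys zs))

permutations⇒↭ : ∀ xs {π} → π ∈ permutations xs → π ↭ xs
permutations⇒↭ []       (here refl) = ↭-refl
permutations⇒↭ (x ∷ xs) π∈
  with ρ , ρ∈ , π∈′ ← find (∈-concatMap⁻ (insertions x) {xs = permutations xs} π∈) =
  ↭-trans (insertions⇒↭ x ρ π∈′) (prep x (permutations⇒↭ xs ρ∈))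

↭⇒permutations : ∀ xs {π} → π ↭ xs → π ∈ permutations xs
↭⇒permutations []       π↭ rewrite ↭-empty-inv π↭ = here refl
↭⇒permutations (x ∷ xs) π↭
  with ys , zs , refl ← ∈-∃++ (∈-resp-↭ (↭-sym π↭) (here refl)) =
  ∈-concatMap⁺ (insertions x)
    (lose (↭⇒permutations xs (drop-mid ys [] π↭)) (∈-insertions x ys zs))

insertions-unique : ∀ x ys → x ∉ ys → Unique (insertions x ys)
insertions-unique x []       x∉ = [] ∷ []
insertions-unique x (y ∷ ys) x∉ =
  All.tabulate (λ zs∈ eq → x∉ (here (∷-injectiveˡ (trans eq (proj₂ (proj₂ (∈-map⁻ _ zs∈)))))))
  ∷ Uniqueₚ.map⁺ ∷-injectiveʳ (insertions-unique x ys (x∉ ∘ there))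

-- Deleting x undoes an insertion, so insertions into different permutations never coincide. This is
-- what `permutations-unique` rests on.
filter-insertions : ∀ x ys {zs} → x ∉ ys → zs ∈ insertions x ys →
                    filter (¬? ∘ (x ℕₚ.≟_)) zs ≡ ys
filter-insertions x ys {zs} x∉ zs∈ = go ys x∉ zs∈
  where
  P? = ¬? ∘ (x ℕₚ.≟_)
  keep : ∀ ys → x ∉ ys → filter P? ys ≡ ys
  keep ys x∉ = filter-all P? (All.tabulate λ { y∈ refl → x∉ y∈ })
  go : ∀ ys {zs} → x ∉ ys → zs ∈ insertions x ys → filter P? zs ≡ ys
  go []       x∉ (here refl) = filter-reject P? λ ¬x → ¬x refl
  go (y ∷ ys) x∉ (here refl) = trans (filter-reject P? λ ¬x → ¬x refl) (keep (y ∷ ys) x∉)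
  go (y ∷ ys) x∉ (there zs∈) with _ , zs∈′ , refl ← ∈-map⁻ _ zs∈ =
    trans (filter-accept P? (λ { refl → x∉ (here refl) }))
          (cong (y ∷_) (go ys (x∉ ∘ there) zs∈′))

permutations-unique : ∀ {xs} → Unique xs → Unique (permutations xs)
permutations-unique {[]}     []        = [] ∷ []
permutations-unique {x ∷ xs} (x∉ ∷ u) =
  Uniqueₚ.concat⁺
    (Allₚ.map⁺ (All.tabulate λ ρ∈ → insertions-unique x _ (x∉ρ ρ∈)))
    (AllPairsₚ.map⁺ (apart (λ ρ∈ → ρ∈) (permutations-unique u)))
  where
  x∉ρ : ∀ {ρ} → ρ ∈ permutations xs → x ∉ ρ
  x∉ρ ρ∈ x∈ = All.lookup x∉ (∈-resp-↭ (permutations⇒↭ xs ρ∈) x∈) refl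
  apart : ∀ {ρs} → (∀ {ρ} → ρ ∈ ρs → ρ ∈ permutations xs) → Unique ρs →
          AllPairs (λ ρ σ → ∀ {π} → ¬ (π ∈ insertions x ρ × π ∈ insertions x σ)) ρs
  apart ⊆ []        = []
  apart ⊆ (ρ∉ ∷ u) =
    All.tabulate (λ {σ} σ∈ (π∈ρ , π∈σ) → All.lookup ρ∉ σ∈
      (trans (sym (filter-insertions x _ (x∉ρ (⊆ (here refl))) π∈ρ))
             (filter-insertions x σ (x∉ρ (⊆ (there σ∈))) π∈σ)))
    ∷ apart (⊆ ∘ there) u

∷⊑⇒∈ : ∀ {x y : ℕ} {zs} → x ∷ y ∷ [] ⊑ zs → x ∈ zs × y ∈ zs
∷⊑⇒∈ s = ⊑-lookup s (here refl) , ⊑-lookup s (there (here refl))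

⊑-tail : ∀ {x y z : ℕ} {zs} → x ≢ z → x ∷ y ∷ [] ⊑ z ∷ zs → x ∷ y ∷ [] ⊑ zs
⊑-tail x≢z (_ ∷ʳ s) = s
⊑-tail x≢z (refl ∷ s) = ⊥-elim (x≢z refl)

-- Once the head fails `P`, nothing after it can satisfy `P`: `before` would place such an element
-- ahead of a second occurrence of the head, against distinctness.
filter-split : ∀ {p} {P : Pred ℕ p} (P? : Decidable P) {π} → Unique π →
  (∀ {x y} → x ∈ π → y ∈ π → P x → ¬ P y → x ∷ y ∷ [] ⊑ π) →
  π ≡ filter P? π ++ filter (¬? ∘ P?) π
filter-split P? {[]}    u before = refl
filter-split {P = P} P? {x ∷ π} (x∉ ∷ u) before with P? x
... | yes Px = cong (x ∷_) (filter-split P? u λ y∈ z∈ Py ¬Pz →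
        ⊑-tail (λ { refl → All.lookup x∉ y∈ refl }) (before (there y∈) (there z∈) Py ¬Pz))
... | no ¬Px = sym (cong₂ (λ ρ σ → ρ ++ x ∷ σ) (filter-none P? none) (filter-all (¬? ∘ P?) none))
  where
  none : All (λ y → ¬ P y) π
  none = All.tabulate λ {y} y∈ Py → All.lookup x∉
    (proj₂ (∷⊑⇒∈ (⊑-tail (λ { refl → ¬Px Py }) (before (there y∈) (here refl) Py ¬Px)))) refl

open LabeledPoset using (labels; unique)

LinearExtension : LabeledPoset → List ℕ → Set
LinearExtension P π = π ↭ labels P × Respects P π

linearExtensions⁻ : ∀ P {π} → π ∈ linearExtensions P → LinearExtension P π
linearExtensions⁻ P π∈ with π∈′ , r ← ∈-filter⁻ (respects? P) {xs = permutations (labels P)} π∈ =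
  permutations⇒↭ (labels P) π∈′ , r

linearExtensions⁺ : ∀ P {π} → LinearExtension P π → π ∈ linearExtensions P
linearExtensions⁺ P (π↭ , r) = ∈-filter⁺ (respects? P) (↭⇒permutations (labels P) π↭) r

linearExtensions-unique : ∀ P → Unique (linearExtensions P)
linearExtensions-unique P = Uniqueₚ.filter⁺ (respects? P) (permutations-unique (unique P))

discrete-linearExtension : ∀ P → (∀ {x y} → LabeledPoset._≤ₚ_ P x y → x ≡ y) →
                           ∀ {π} → π ↭ labels P → LinearExtension P π
discrete-linearExtension P discrete π↭ = π↭ , λ x y (x≤y , x≢y) → ⊥-elim (x≢y (discrete x≤y))

module _ (P Q : LabeledPoset) (P⟂Q : P ⟂ Q) where

  -- The two pieces are the subsequences with labels in P and in Q. The cross relations put the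
  -- first wholly before the second, and filtering keeps the relations inside each summand.
  ordinalSum-linearExtension⁻ : ∀ {π} → LinearExtension (ordinalSum P Q P⟂Q) π →
    ∃ λ σ → ∃ λ τ → π ≡ σ ++ τ × LinearExtension P σ × LinearExtension Q τ
  ordinalSum-linearExtension⁻ {π} (π↭ , r) =
    filter ∈P? π , filter (¬? ∘ ∈P?) π ,
    filter-split ∈P? (Unique-resp-↭ (setoid ℕ) (↭⇒↭ₛ (↭-sym π↭))
                       (unique (ordinalSum P Q P⟂Q))) before ,
    (subst (filter ∈P? π ↭_) filterP (filter-↭ ∈P? π↭) ,
     λ x y (x≤y , x≢y) → let x∈ , y∈ = LabeledPoset.≤ₚ⇒∈ P x≤y in
       restrict ∈P? x∈ y∈ (r x y (inj₁ x≤y , x≢y))) ,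
    (subst (filter (¬? ∘ ∈P?) π ↭_) filterQ (filter-↭ (¬? ∘ ∈P?) π↭) ,
     λ x y (x≤y , x≢y) → let x∈ , y∈ = LabeledPoset.≤ₚ⇒∈ Q x≤y in
       restrict (¬? ∘ ∈P?) (∉P x∈) (∉P y∈) (r x y (inj₂ (inj₁ x≤y) , x≢y)))
    where
    ∈P? : Decidable (_∈ labels P)
    ∈P? x = _∈?_ ℕₚ._≟_ x (labels P)
    ∉P : ∀ {x} → x ∈ labels Q → ¬ (x ∈ labels P)
    ∉P x∈Q x∈P = P⟂Q (x∈P , x∈Q)
    restrict : ∀ {p} {R : Pred ℕ p} (R? : Decidable R) {x y} → R x → R y →
               x ∷ y ∷ [] ⊑ π → x ∷ y ∷ [] ⊑ filter R? π
    restrict R? {x} {y} Rx Ry s =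
      subst (_⊑ filter R? π) (filter-all R? (Rx ∷ Ry ∷ []))
            (Sublistₚ.filter⁺ R? R? (λ { refl → id }) s)
    before : ∀ {x y} → x ∈ π → y ∈ π → x ∈ labels P → ¬ (y ∈ labels P) → x ∷ y ∷ [] ⊑ π
    before {x} {y} _ y∈ x∈P y∉P with ∈-++⁻ (labels P) (∈-resp-↭ π↭ y∈)
    ... | inj₁ y∈P = ⊥-elim (y∉P y∈P)
    ... | inj₂ y∈Q = r x y (inj₂ (inj₂ (x∈P , y∈Q)) , λ { refl → y∉P x∈P })
    filterP : filter ∈P? (labels P ++ labels Q) ≡ labels P
    filterP = trans (filter-++ ∈P? (labels P) (labels Q))
      (trans (cong₂ _++_ (filter-all ∈P? (All.tabulate id)) (filter-none ∈P? (All.tabulate ∉P)))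
             (++-identityʳ _))
    filterQ : filter (¬? ∘ ∈P?) (labels P ++ labels Q) ≡ labels Q
    filterQ = trans (filter-++ (¬? ∘ ∈P?) (labels P) (labels Q))
      (cong₂ _++_ (filter-none (¬? ∘ ∈P?) (All.tabulate λ x∈ x∉ → x∉ x∈))
                  (filter-all (¬? ∘ ∈P?) (All.tabulate ∉P)))

  ordinalSum-linearExtension⁺ : ∀ {σ τ} → LinearExtension P σ → LinearExtension Q τ →
    LinearExtension (ordinalSum P Q P⟂Q) (σ ++ τ)
  ordinalSum-linearExtension⁺ {σ} {τ} (σ↭ , rσ) (τ↭ , rτ) =
    ↭-++⁺ σ↭ τ↭ , respects
    where
    respects : Respects (ordinalSum P Q P⟂Q) (σ ++ τ)
    respects x y (inj₁ x≤y , x≢y)        = Sublistₚ.++⁺ʳ τ (rσ x y (x≤y , x≢y))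
    respects x y (inj₂ (inj₁ x≤y) , x≢y) = Sublistₚ.++⁺ˡ σ (rτ x y (x≤y , x≢y))
    respects x y (inj₂ (inj₂ (x∈ , y∈)) , _) =
      Sublistₚ.++⁺ (from∈ (∈-resp-↭ (↭-sym σ↭) x∈)) (from∈ (∈-resp-↭ (↭-sym τ↭) y∈))

-- Compositions as words

Word : Set
Word = List Bool

-- Only lists of equal length are comparable. Otherwise the order on words would admit the infinite
-- descent d, ad, aad, ....
data Lex {A : Set} (_≺_ : Rel A 0ℓ) : Rel (List A) 0ℓ where
  here  : ∀ {x y xs ys} → x ≺ y → length xs ≡ length ys → Lex _≺_ (x ∷ xs) (y ∷ ys)
  there : ∀ {x xs ys} → Lex _≺_ xs ys → Lex _≺_ (x ∷ xs) (x ∷ ys)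

module _ {A : Set} {_≺_ : Rel A 0ℓ} where

  Lex-length : ∀ {xs ys} → Lex _≺_ xs ys → length xs ≡ length ys
  Lex-length (here _ e) = cong suc e
  Lex-length (there p)  = cong suc (Lex-length p)

  Lex-flip : ∀ {xs ys} → Lex _≺_ xs ys → Lex (flip _≺_) ys xs
  Lex-flip (here p e) = here p (sym e)
  Lex-flip (there p)  = there (Lex-flip p)

  Lex-++⁺ : ∀ ps {xs ys} → Lex _≺_ xs ys → Lex _≺_ (ps ++ xs) (ps ++ ys)
  Lex-++⁺ []       p = p
  Lex-++⁺ (_ ∷ ps) p = there (Lex-++⁺ ps p)

  Lex-irrefl : (∀ {x} → ¬ x ≺ x) → ∀ {xs} → ¬ Lex _≺_ xs xs
  Lex-irrefl irr (here p _) = irr p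
  Lex-irrefl irr (there p)  = Lex-irrefl irr p

  -- Induction on the length, then on the head, then on the tail. A smaller head may carry any tail
  -- of the same length, so `tails` provides accessibility for all of them.
  Lex-wellFounded : WellFounded _≺_ → WellFounded (Lex _≺_)
  Lex-wellFounded wf xs = go (length xs) xs refl
    where
    ∷-acc : ∀ {n x xs} → (∀ ys → length ys ≡ n → Acc (Lex _≺_) ys) → Acc _≺_ x →
            Acc (Lex _≺_) xs → length xs ≡ n → ∀ {zs} → Lex _≺_ zs (x ∷ xs) → Acc (Lex _≺_) zs
    ∷-acc tails (acc rx) _ e (here y≺x e′) =
      acc (∷-acc tails (rx y≺x) (tails _ (trans e′ e)) (trans e′ e))
    ∷-acc tails ax (acc rxs) e (there p) =
      acc (∷-acc tails ax (rxs p) (trans (Lex-length p) e))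
    go : ∀ n xs → length xs ≡ n → Acc (Lex _≺_) xs
    go _       []       _ = acc λ ()
    go (suc n) (x ∷ xs) e =
      acc (∷-acc (go n) (wf x) (go n xs (ℕₚ.suc-injective e)) (ℕₚ.suc-injective e))

infix 4 _⊏_ _⊏?_ _⊴_

_⊏_ : Rel Word 0ℓ
_⊏_ = Lex Bool._<_

⊏-wellFounded : WellFounded _⊏_
⊏-wellFounded = Lex-wellFounded Boolₚ.<-wellFounded

-- Spanning recurses to larger words and independence to smaller ones, so the order is needed in
-- both directions.
⊐-wellFounded : WellFounded (flip _⊏_)
⊐-wellFounded = Subrelation.wellFounded Lex-flip (Lex-wellFounded >-wellFounded)
  where
  >-wellFounded : WellFounded (flip Bool._<_)
  >-wellFounded true  = acc λ ()
  >-wellFounded false = acc λ { f<t → >-wellFounded true }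

_⊏?_ : Binary.Decidable _⊏_
[]          ⊏? _           = no λ ()
(_ ∷ _)     ⊏? []          = no λ ()
(false ∷ u) ⊏? (true ∷ v)  = map′ (here f<t) (λ { (here _ e) → e }) (length u ℕₚ.≟ length v)
(true ∷ _)  ⊏? (false ∷ _) = no λ { (here () _) }
(false ∷ u) ⊏? (false ∷ v) = map′ there (λ { (there p) → p }) (u ⊏? v)
(true ∷ u)  ⊏? (true ∷ v)  = map′ there (λ { (there p) → p }) (u ⊏? v)

_⊴_ : Rel Word 0ℓ
_⊴_ = Pointwise Bool._≤_

-- Letterwise comparison is refinement reversed, by `≼⇒⊴` and `⊴⇒≼`. Hence strict refinements have
-- larger words, and the expansion of L into monomials can use the same well-founded recursion as
-- that of N.
⊴∧≢⇒⊏ : ∀ {u v} → u ⊴ v → u ≢ v → u ⊏ v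
⊴∧≢⇒⊏ []          u≢v = ⊥-elim (u≢v refl)
⊴∧≢⇒⊏ (f≤t ∷ u⊴v) u≢v = here f<t (Pointwiseₚ.Pointwise-length u⊴v)
⊴∧≢⇒⊏ (b≤b ∷ u⊴v) u≢v = there (⊴∧≢⇒⊏ u⊴v (u≢v ∘ cong (_ ∷_)))

-- The i-th letter records whether i is a proper partial sum.
composition : Word → Composition
first : Word → ℕ
rest  : Word → Composition

composition w = 1+ first w ∷ rest w

first []          = 0
first (false ∷ w) = suc (first w)
first (true ∷ w)  = 0

rest []          = []
rest (false ∷ w) = rest w
rest (true ∷ w)  = composition w

-- A nonempty composition has one letter fewer than its weight; `boundary` adds the `true` that
-- separates a part from the next. The empty composition shares the empty word with the composition
-- 1, so it is treated apart later.
word     : Composition → Word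
boundary : Composition → Word

word []         = []
word (1+ a ∷ α) = replicate a false ++ boundary α

boundary []        = []
boundary α@(_ ∷ _) = true ∷ word α

word-composition : ∀ w → word (composition w) ≡ w
word-composition []          = refl
word-composition (true ∷ w)  = cong (true ∷_) (word-composition w)
word-composition (false ∷ w) = cong (false ∷_) (word-composition w)

composition-word : ∀ a α → composition (word (a ∷ α)) ≡ a ∷ α
composition-word (1+ a) α = cong₂ (λ b β → 1+ b ∷ β) (first-word a) (rest-word a)
  where
  first-boundary : ∀ α → first (boundary α) ≡ 0
  first-boundary []      = refl
  first-boundary (_ ∷ _) = refl
  rest-boundary : ∀ α → rest (boundary α) ≡ α
  rest-boundary []      = refl
  rest-boundary (b ∷ β) = composition-word b β
  first-word : ∀ a → first (replicate a false ++ boundary α) ≡ a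
  first-word zero    = first-boundary α
  first-word (suc a) = cong suc (first-word a)
  rest-word : ∀ a → rest (replicate a false ++ boundary α) ≡ α
  rest-word zero    = rest-boundary α
  rest-word (suc a) = rest-word a

weight-composition : ∀ w → weight (composition w) ≡ suc (length w)
weight-composition []          = refl
weight-composition (false ∷ w) = cong suc (weight-composition w)
weight-composition (true ∷ w)  = cong suc (weight-composition w)

length-word : ∀ a α → suc (length (word (a ∷ α))) ≡ weight (a ∷ α)
length-word a α =
  trans (sym (weight-composition (word (a ∷ α)))) (cong weight (composition-word a α))

positions : Word → List ℕ
positions []          = []
positions (false ∷ w) = map suc (positions w)
positions (true ∷ w)  = 1 ∷ map suc (positions w)

properPartialSums-composition : ∀ w → properPartialSums (composition w) ≡ positions w
properPartialSums-composition []          = refl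
properPartialSums-composition (true ∷ w)  =
  cong (λ xs → 1 ∷ map suc xs) (properPartialSums-composition w)
properPartialSums-composition (false ∷ w) =
  trans (shift (first w) (rest w)) (cong (map suc) (properPartialSums-composition w))
  where
  shift : ∀ a α → properPartialSums (1+ suc a ∷ α) ≡ map suc (properPartialSums (1+ a ∷ α))
  shift a []      = refl
  shift a (b ∷ α) = cong (suc (suc a) ∷_) (map-∘ (properPartialSums (b ∷ α)))

0∉positions : ∀ w → ¬ (0 ∈ positions w)
0∉positions (false ∷ w) 0∈ with _ , _ , () ← ∈-map⁻ suc 0∈
0∉positions (true ∷ w) (there 0∈) with _ , _ , () ← ∈-map⁻ suc 0∈

suc∈map-suc : ∀ {n xs} → suc n ∈ map suc xs → n ∈ xs
suc∈map-suc n∈ with _ , n∈′ , refl ← ∈-map⁻ suc n∈ = n∈′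

positions-⊆⇒⊴ : ∀ {u v} → length v ≡ length u → positions u ⊆ positions v → u ⊴ v
positions-⊆⇒⊴ {[]}    {[]}    _ _ = []
positions-⊆⇒⊴ {x ∷ u} {y ∷ v} e u⊆v =
  letter x y u⊆v ∷ positions-⊆⇒⊴ (ℕₚ.suc-injective e) λ n∈ →
    lower y (0∉positions u) n∈ (u⊆v (raise x n∈))
  where
  letter : ∀ x y → positions (x ∷ u) ⊆ positions (y ∷ v) → x Bool.≤ y
  letter false y     _ = Boolₚ.≤-minimum y
  letter true  true  _ = b≤b
  letter true  false h = ⊥-elim (0∉positions v (suc∈map-suc (h (here refl))))
  raise : ∀ x {n} → n ∈ positions u → suc n ∈ positions (x ∷ u)
  raise false = ∈-map⁺ suc
  raise true  = there ∘ ∈-map⁺ suc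
  lower : ∀ y {n} → ¬ (0 ∈ positions u) → n ∈ positions u → suc n ∈ positions (y ∷ v) →
          n ∈ positions v
  lower false _  _  n∈          = suc∈map-suc n∈
  lower true  0∉ 0∈ (here refl) = ⊥-elim (0∉ 0∈)
  lower true  _  _  (there n∈)  = suc∈map-suc n∈

⊴⇒positions-⊆ : ∀ {u v} → u ⊴ v → positions u ⊆ positions v
⊴⇒positions-⊆ {false ∷ _} (f≤t ∷ p) n∈
  with _ , n∈′ , refl ← ∈-map⁻ suc n∈ = there (∈-map⁺ suc (⊴⇒positions-⊆ p n∈′))
⊴⇒positions-⊆ {false ∷ _} (b≤b ∷ p) n∈
  with _ , n∈′ , refl ← ∈-map⁻ suc n∈ = ∈-map⁺ suc (⊴⇒positions-⊆ p n∈′)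
⊴⇒positions-⊆ {true ∷ _} (b≤b ∷ p) (here refl) = here refl
⊴⇒positions-⊆ {true ∷ _} (b≤b ∷ p) (there n∈)
  with _ , n∈′ , refl ← ∈-map⁻ suc n∈ = there (∈-map⁺ suc (⊴⇒positions-⊆ p n∈′))

≼⇒⊴ : ∀ {u v} → composition u ≼ composition v → v ⊴ u
≼⇒⊴ {u} {v} (e , v⊆u) = positions-⊆⇒⊴
  (ℕₚ.suc-injective (trans (sym (weight-composition u)) (trans e (weight-composition v))))
  λ {n} n∈ → subst (n ∈_) (properPartialSums-composition u)
    (v⊆u (subst (n ∈_) (sym (properPartialSums-composition v)) n∈))

⊴⇒≼ : ∀ {u v} → v ⊴ u → composition u ≼ composition v
⊴⇒≼ {u} {v} v⊴u =
  trans (weight-composition u) (trans (cong suc (sym (Pointwiseₚ.Pointwise-length v⊴u)))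
    (sym (weight-composition v))) ,
  λ {n} n∈ → subst (n ∈_) (sym (properPartialSums-composition u))
    (⊴⇒positions-⊆ v⊴u (subst (n ∈_) (properPartialSums-composition v) n∈))

-- `changes` takes differences and `accumulate` partial sums modulo 2, with `b` as the letter
-- preceding the word.
changes : Bool → Word → Word
changes b []      = []
changes b (x ∷ w) = (b xor x) ∷ changes x w

accumulate : Bool → Word → Word
accumulate b []      = []
accumulate b (x ∷ w) = (b xor x) ∷ accumulate (b xor x) w

xor-involutive : ∀ b x → b xor (b xor x) ≡ x
xor-involutive false x = refl
xor-involutive true  x = Boolₚ.not-involutive x

accumulate-changes : ∀ b w → accumulate b (changes b w) ≡ w
accumulate-changes b []      = refl
accumulate-changes b (x ∷ w) rewrite xor-involutive b x = cong (x ∷_) (accumulate-changes x w)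

changes-accumulate : ∀ b w → changes b (accumulate b w) ≡ w
changes-accumulate b []      = refl
changes-accumulate b (x ∷ w) = cong₂ _∷_ (xor-involutive b x) (changes-accumulate (b xor x) w)

length-changes : ∀ b w → length (changes b w) ≡ length w
length-changes b []      = refl
length-changes b (x ∷ w) = cong suc (length-changes x w)

-- Coordinate functionals of the fundamental basis

coefficientOf : Composition → Functional
coefficientOf α = coefficientAt α (firstVariables (length α))

-- Möbius inversion of f ↦ (w ↦ coefficient of 𝐱^ (φ w) in f) over the
-- Boolean lattice of words.
möbius : (Word → Composition) → Word → Functional
möbius φ []          = coefficientOf (φ [])
möbius φ (false ∷ w) = möbius (φ ∘ (false ∷_)) w
möbius φ (true ∷ w)  = möbius (φ ∘ (true ∷_)) w ⊖ möbius (φ ∘ (false ∷_)) w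

-- A row of the zeta function of the Boolean lattice, extended by 0 to words of other lengths. The
-- coefficients of a single L form such a row, by `L-zeta`.
IsZeta : Word → (Word → ℤ) → Set
IsZeta v g = (∀ u → v ⊴ u → g u ≡ 1ℤ) × (∀ u → ¬ v ⊴ u → g u ≡ 0ℤ)

module _ (f : QSym) where

  private
    values : (Word → Composition) → Word → ℤ
    values φ u = apply (coefficientOf (φ u)) f

  möbius-zero : ∀ φ w → (∀ u → values φ u ≡ 0ℤ) → apply (möbius φ w) f ≡ 0ℤ
  möbius-zero φ []          h = h []
  möbius-zero φ (false ∷ w) h = möbius-zero _ w (h ∘ (false ∷_))
  möbius-zero φ (true ∷ w)  h =
    cong₂ ℤ._-_ (möbius-zero _ w (h ∘ (true ∷_))) (möbius-zero _ w (h ∘ (false ∷_)))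

  möbius-cong : ∀ φ ψ w → (∀ u → values φ u ≡ values ψ u) →
                apply (möbius φ w) f ≡ apply (möbius ψ w) f
  möbius-cong φ ψ []          h = h []
  möbius-cong φ ψ (false ∷ w) h = möbius-cong _ _ w (h ∘ (false ∷_))
  möbius-cong φ ψ (true ∷ w)  h =
    cong₂ ℤ._-_ (möbius-cong _ _ w (h ∘ (true ∷_))) (möbius-cong _ _ w (h ∘ (false ∷_)))

  private
    zeta-tail : ∀ {φ x y v} → x Bool.≤ y → IsZeta (x ∷ v) (values φ) →
                IsZeta v (values (φ ∘ (y ∷_)))
    zeta-tail x≤y (one , zer) =
      (λ u v⊴u → one _ (x≤y ∷ v⊴u)) , λ u v⋬u → zer _ λ { (_ ∷ v⊴u) → v⋬u v⊴u }

    zeta-true-false : ∀ {φ v} → IsZeta (true ∷ v) (values φ) → ∀ u → values (φ ∘ (false ∷_)) u ≡ 0ℤ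
    zeta-true-false (_ , zer) u = zer _ λ { (() ∷ _) }

  möbius-self : ∀ φ w → IsZeta w (values φ) → apply (möbius φ w) f ≡ 1ℤ
  möbius-self φ []          ζ = proj₁ ζ [] []
  möbius-self φ (false ∷ w) ζ = möbius-self _ w (zeta-tail b≤b ζ)
  möbius-self φ (true ∷ w)  ζ =
    cong₂ ℤ._-_ (möbius-self _ w (zeta-tail b≤b ζ)) (möbius-zero _ w (zeta-true-false ζ))

  -- Equal letters are peeled off. If v has `true` against `false` in w, the values left to consider
  -- are all 0. If v has `false` against `true`, the restrictions to the two letters agree and
  -- cancel. If the lengths differ, all relevant values are 0.
  möbius-other : ∀ φ v w → v ≢ w → IsZeta v (values φ) → apply (möbius φ w) f ≡ 0ℤ
  möbius-other φ []          []          v≢w ζ = ⊥-elim (v≢w refl)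
  möbius-other φ (_ ∷ _)     []          v≢w ζ = proj₂ ζ [] λ ()
  möbius-other φ []          (false ∷ w) v≢w ζ = möbius-zero _ w λ u → proj₂ ζ _ λ ()
  möbius-other φ []          (true ∷ w)  v≢w ζ =
    cong₂ ℤ._-_ (möbius-zero _ w λ u → proj₂ ζ _ λ ()) (möbius-zero _ w λ u → proj₂ ζ _ λ ())
  möbius-other φ (false ∷ v) (false ∷ w) v≢w ζ =
    möbius-other _ v w (v≢w ∘ cong (false ∷_)) (zeta-tail b≤b ζ)
  möbius-other φ (true ∷ v)  (false ∷ w) v≢w ζ = möbius-zero _ w (zeta-true-false ζ)
  möbius-other φ (true ∷ v)  (true ∷ w)  v≢w ζ =
    cong₂ ℤ._-_ (möbius-other _ v w (v≢w ∘ cong (true ∷_)) (zeta-tail b≤b ζ))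
                (möbius-zero _ w (zeta-true-false ζ))
  möbius-other φ (false ∷ v) (true ∷ w)  v≢w ζ = ℤₚ.i≡j⇒i-j≡0
    (möbius-cong _ _ w λ u → same u)
    where
    same : ∀ u → values φ (true ∷ u) ≡ values φ (false ∷ u)
    same u with Pointwiseₚ.decidable Boolₚ._≤?_ v u
    ... | yes v⊴u = trans (proj₁ ζ _ (f≤t ∷ v⊴u)) (sym (proj₁ ζ _ (b≤b ∷ v⊴u)))
    ... | no v⋬u = trans (proj₂ ζ _ λ { (_ ∷ p) → v⋬u p }) (sym (proj₂ ζ _ λ { (_ ∷ p) → v⋬u p }))

L-zeta : ∀ v → IsZeta v (λ u → apply (coefficientOf (composition u)) (L (composition v)))
L-zeta v = (λ u v⊴u → L-coefficient-≼ (composition v) (composition u) _ (⊴⇒≼ v⊴u)) ,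
           (λ u v⋬u → L-coefficient-⋠ (composition v) (composition u) _ (v⋬u ∘ ≼⇒⊴))

L-coordinate : Word → Functional
L-coordinate = möbius composition

L-coordinate-self : ∀ w → apply (L-coordinate w) (L (composition w)) ≡ 1ℤ
L-coordinate-self w = möbius-self (L (composition w)) composition w (L-zeta w)

L-coordinate-other : ∀ v w → v ≢ w → apply (L-coordinate w) (L (composition v)) ≡ 0ℤ
L-coordinate-other v w v≢w = möbius-other (L (composition v)) composition v w v≢w (L-zeta v)

-- Descent words and increasing runs

descents : List ℕ → Word
descents []          = []
descents (x ∷ [])    = []
descents (x ∷ y ∷ π) = not (does (x ℕₚ.<? y)) ∷ descents (y ∷ π)

C-descents : ∀ x π → C (x ∷ π) ≡ composition (descents (x ∷ π))
C-descents x []      = refl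
C-descents x (y ∷ π) with runs (y ∷ π) | runs-head y π | C-descents y π
  where
  -- `extend` compares x with the head of the first run, which is `y` itself.
  runs-head : ∀ y π → ∃ λ ys → ∃ λ r → runs (y ∷ π) ≡ (y ∷ ys) ∷ r
  runs-head y []      = _ , _ , refl
  runs-head y (z ∷ π) with runs (z ∷ π) | runs-head z π
  ... | _ | _ , _ , refl with does (y ℕₚ.<? z)
  ...   | true  = _ , _ , refl
  ...   | false = _ , _ , refl
... | _ | ys , r , refl | e with does (x ℕₚ.<? y)
...   | false = cong ((1+ 0) ∷_) e
...   | true  = cong (λ { [] → [] ; (1+ a ∷ α) → 1+ suc a ∷ α }) e

-- Linear extensions of P_α

isDescent : ℕ → ℕ → Bool
isDescent x y = not (does (x ℕₚ.<? y))

isDescent-< : ∀ {x y} → x < y → isDescent x y ≡ false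
isDescent-< {x} {y} x<y = cong not (dec-true (x ℕₚ.<? y) x<y)

isDescent-≥ : ∀ {x y} → y ≤ x → isDescent x y ≡ true
isDescent-≥ {x} {y} y≤x = cong not (dec-false (x ℕₚ.<? y) (ℕₚ.≤⇒≯ y≤x))

Monotone : Bool → List ℕ → Set
Monotone b = Linked (λ x y → isDescent x y ≡ b)

-- The monotone arrangement of a block is its sorted list, for the reversed order when `b` is
-- `true`. This is why only one extension has all its blocks monotone in the prescribed directions.
monotone-unique : ∀ b {σ τ} → Monotone b σ → Monotone b τ → σ ↭ τ → σ ≡ τ
monotone-unique false mσ mτ p = Pointwise-≡⇒≡
  (↗↭↗⇒≋ ℕₚ.≤-totalOrder (Linked.map ascent mσ) (Linked.map ascent mτ) (↭⇒↭ₛ p))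
  where
  ascent : ∀ {x y} → isDescent x y ≡ false → x ≤ y
  ascent {x} {y} e with x ℕₚ.≤? y
  ... | yes x≤y = x≤y
  ... | no x≰y with () ← trans (sym e) (isDescent-≥ (ℕₚ.≰⇒≥ x≰y))
monotone-unique true mσ mτ p = Pointwise-≡⇒≡
  (↗↭↗⇒≋ (Flip.totalOrder ℕₚ.≤-totalOrder) (Linked.map descent mσ) (Linked.map descent mτ) (↭⇒↭ₛ p))
  where
  descent : ∀ {x y} → isDescent x y ≡ true → y ≤ x
  descent {x} {y} e with y ℕₚ.≤? x
  ... | yes y≤x = y≤x
  ... | no y≰x with () ← trans (sym e) (isDescent-< (ℕₚ.≰⇒> y≰x))

last : ℕ → List ℕ → ℕ
last x []      = x
last x (y ∷ σ) = last y σ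

last∈ : ∀ x σ → last x σ ∈ x ∷ σ
last∈ x []      = here refl
last∈ x (y ∷ σ) = there (last∈ y σ)

length-descents : ∀ x π → length (descents (x ∷ π)) ≡ length π
length-descents x []      = refl
length-descents x (y ∷ π) = cong suc (length-descents y π)

-- Within a block running in direction `b` no letter changes; the next possible change is at the
-- step out of its last element.
changes-monotone : ∀ b x σ τ → Monotone b (x ∷ σ) →
  changes b (descents (x ∷ σ ++ τ)) ≡
  replicate (length σ) false ++ changes b (descents (last x σ ∷ τ))
changes-monotone b x []      τ [-]     = refl
changes-monotone b x (y ∷ σ) τ (e ∷ m) rewrite e =
  cong₂ _∷_ (Boolₚ.xor-same b) (changes-monotone b y σ τ m)

-- The first step against direction `b` is a change where the left word still has `false`. That
-- decides the comparison, so only the length of `w` matters.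
monotone-or-⊏ : ∀ b x σ τ w → length w ≡ length τ →
  Monotone b (x ∷ σ) ⊎ replicate (length σ) false ++ w ⊏ changes b (descents (x ∷ σ ++ τ))
monotone-or-⊏ b x []      τ w e = inj₁ [-]
monotone-or-⊏ b x (y ∷ σ) τ w e with isDescent x y in eq
... | d with d Boolₚ.≟ b
...   | yes refl with monotone-or-⊏ b y σ τ w e
...     | inj₁ m = inj₁ (eq ∷ m)
...     | inj₂ p rewrite Boolₚ.xor-same b = inj₂ (there p)
monotone-or-⊏ b x (y ∷ σ) τ w e | d | no d≢b = inj₂ (subst
  (λ z → false ∷ replicate (length σ) false ++ w ⊏ z ∷ changes d (descents (y ∷ σ ++ τ)))
  (sym (xor-≢ b d d≢b))
  (here Bool.f<t (trans (length-++ (replicate (length σ) false))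
    (trans (cong₂ ℕ._+_ (length-replicate (length σ)) e)
    (sym (trans (length-changes d (descents (y ∷ σ ++ τ))) (trans
      (length-descents y (σ ++ τ)) (length-++ σ))))))))
  where
  xor-≢ : ∀ b d → d ≢ b → b xor d ≡ true
  xor-≢ false false d≢b = ⊥-elim (d≢b refl)
  xor-≢ false true  d≢b = refl
  xor-≢ true  false d≢b = refl
  xor-≢ true  true  d≢b = ⊥-elim (d≢b refl)

interval : ℕ → ℕ → List ℕ
interval s k = labels (intervalAntichain s k)

block : Bool → ℕ → ℕ → List ℕ
block false s k = interval s k
block true  s k = reverse (interval s k)

block-↭ : ∀ b s k → block b s k ↭ interval s k
block-↭ false s k = ↭-refl
block-↭ true  s k = ↭-reverse (interval s k)

block-monotone : ∀ b s k → Monotone b (block b s k)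
block-monotone false s k = Linkedₚ.applyUpTo⁺₂ (λ i → suc (s ℕ.+ i)) k λ i →
  isDescent-< (ℕ.s≤s (ℕₚ.+-monoʳ-< s (ℕₚ.n<1+n i)))
block-monotone true s k = subst (Monotone true) (sym (reverse-applyUpTo (λ i → suc (s ℕ.+ i)) k))
  (Linkedₚ.applyDownFrom⁺₂ (λ i → suc (s ℕ.+ i)) k λ i →
    isDescent-≥ (ℕ.s≤s (ℕₚ.+-monoʳ-≤ s (ℕₚ.n≤1+n i))))

-- The linear extensions of P_α unfolded: any arrangement of A₁, then any of A₂, and so on. As in
-- `antichains`, `s` and `t` swap roles at each block.
Blocks : ℕ → ℕ → Composition → List ℕ → Set
Blocks s t []      π = π ≡ []
Blocks s t (a ∷ α) π = ∃ λ σ → ∃ λ τ →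
  π ≡ σ ++ τ × σ ↭ interval s (value a) × Blocks t (s ℕ.+ value a) α τ

linearExtension⇒Blocks : ∀ s t α (p : AllPairs _⟂_ (antichains s t α)) {π} →
                         LinearExtension (⨁ (antichains s t α) p) π → Blocks s t α π
linearExtension⇒Blocks s t []      []       (π↭ , _) = ↭-empty-inv π↭
linearExtension⇒Blocks s t (a ∷ α) (P⟂ ∷ p) ext
  with σ , τ , eq , (σ↭ , _) , ext′ ← ordinalSum-linearExtension⁻
         (intervalAntichain s (value a)) (⨁ (antichains t (s ℕ.+ value a) α) p)
         (⟂-⨁ {intervalAntichain s (value a)} p P⟂) ext
  = σ , τ , eq , σ↭ , linearExtension⇒Blocks t (s ℕ.+ value a) α p ext′

Blocks⇒linearExtension : ∀ s t α (p : AllPairs _⟂_ (antichains s t α)) {π} →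
                         Blocks s t α π → LinearExtension (⨁ (antichains s t α) p) π
Blocks⇒linearExtension s t []      []       refl = discrete-linearExtension (⨁ [] []) proj₂ ↭-refl
Blocks⇒linearExtension s t (a ∷ α) (P⟂ ∷ p) (σ , τ , refl , σ↭ , B) =
  ordinalSum-linearExtension⁺
    (intervalAntichain s (value a)) (⨁ (antichains t (s ℕ.+ value a) α) p)
    (⟂-⨁ {intervalAntichain s (value a)} p P⟂)
    (discrete-linearExtension (intervalAntichain s (value a)) proj₂ σ↭)
    (Blocks⇒linearExtension t (s ℕ.+ value a) α p B)

Blocks-length : ∀ s t α {π} → Blocks s t α π → length π ≡ weight α
Blocks-length s t []      refl = refl
Blocks-length s t (a ∷ α) (σ , τ , refl , σ↭ , B) = trans (length-++ σ)
  (cong₂ ℕ._+_ (trans (↭-length σ↭) (length-applyUpTo (λ i → suc (s ℕ.+ i)) (value a)))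
               (Blocks-length t (s ℕ.+ value a) α B))

-- b tells whether the labels following s lie below those following t.
Ordered : Bool → ℕ → ℕ → Composition → Set
Ordered false s t α = t ℕ.+ evenWeight α ≤ s
Ordered true  s t α = s ℕ.+ oddWeight α ≤ t

Ordered-tail : ∀ b s t a α → Ordered b s t (a ∷ α) → Ordered (not b) t (s ℕ.+ value a) α
Ordered-tail false s t a α o = ℕₚ.≤-trans o (ℕₚ.m≤m+n s _)
Ordered-tail true  s t a α o = ℕₚ.≤-trans (ℕₚ.≤-reflexive (ℕₚ.+-assoc s (value a) (evenWeight α))) o

-- This is where the labelling enters: all labels of one antichain lie on the same side of all
-- labels of the next, so the step between them is forced.
junction : ∀ b s t a c α {x y} → Ordered b s t (a ∷ c ∷ α) →
           x ∈ interval s (value a) → y ∈ interval t (value c) → isDescent x y ≡ not b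
junction false s t a c α o x∈ y∈
  with s<x , _ ← ∈-interval s (value a) x∈ | _ , y≤ ← ∈-interval t (value c) y∈ =
  isDescent-≥ (ℕₚ.<⇒≤ (ℕₚ.≤-<-trans
    (ℕₚ.≤-trans y≤ (ℕₚ.≤-trans (ℕₚ.+-monoʳ-≤ t (ℕₚ.m≤m+n (value c) _)) o)) s<x))
junction true s t a c α o x∈ y∈
  with _ , x≤ ← ∈-interval s (value a) x∈ | t<y , _ ← ∈-interval t (value c) y∈ =
  isDescent-< (ℕₚ.≤-<-trans
    (ℕₚ.≤-trans x≤ (ℕₚ.≤-trans (ℕₚ.+-monoʳ-≤ s (ℕₚ.m≤m+n (value a) _)) o)) t<y)

canonical : Bool → ℕ → ℕ → Composition → List ℕ
canonical b s t []      = []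
canonical b s t (a ∷ α) = block b s (value a) ++ canonical (not b) t (s ℕ.+ value a) α

canonical-Blocks : ∀ b s t α → Blocks s t α (canonical b s t α)
canonical-Blocks b s t []      = refl
canonical-Blocks b s t (a ∷ α) =
  _ , _ , refl , block-↭ b s (value a) , canonical-Blocks (not b) t (s ℕ.+ value a) α

nonempty : ∀ {s k σ} → σ ↭ interval s (suc k) → ∃ λ x → ∃ λ σ′ → σ ≡ x ∷ σ′ × length σ′ ≡ k
nonempty {s} {k} {[]}    σ↭ with () ← ↭-length σ↭
nonempty {s} {k} {x ∷ σ} σ↭ = x , σ , refl ,
  ℕₚ.suc-injective (trans (↭-length σ↭) (length-applyUpTo (λ i → suc (s ℕ.+ i)) (suc k)))

-- The same `b` is the direction of a block and the side of its labels. An increasing block lies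
-- above the next one and is left by a descent, a decreasing block lies below and is left by an
-- ascent, so every junction is a change.
changes-junction : ∀ b s t a c α {x τ} → Ordered b s t (a ∷ c ∷ α) →
  x ∈ interval s (value a) → Blocks t (s ℕ.+ value a) (c ∷ α) τ →
  changes b (descents (x ∷ τ)) ≡ true ∷ changes (not b) (descents τ)
changes-junction b s t a c α {x} o x∈ (σ , τ , refl , σ↭ , _)
  with y , σ′ , refl , _ ← nonempty σ↭
  rewrite junction b s t a c α {x} {y} o x∈ (∈-resp-↭ σ↭ (here refl)) =
  cong (_∷ changes (not b) (descents (y ∷ σ′ ++ τ))) (Boolₚ.xor-inverseʳ b)

length-boundary : ∀ s t α {τ} → Blocks s t α τ → length (boundary α) ≡ length τ
length-boundary s t []      refl = refl
length-boundary s t (a ∷ α) B    = trans (length-word a α) (sym (Blocks-length s t (a ∷ α) B))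

-- A block of size k + 1 contributes k non-changes and each junction one change, which spells out
-- `word α`.
canonical-changes : ∀ b s t α → Ordered b s t α →
                    changes b (descents (canonical b s t α)) ≡ word α
canonical-changes b s t []      o = refl
canonical-changes b s t (a@(1+ k) ∷ α) o
  with block b s (value a) | block-↭ b s (value a) | block-monotone b s (value a)
... | σ | σ↭ | m with x , σ′ , refl , refl ← nonempty σ↭ =
  trans (changes-monotone b x σ′ _ m) (cong (replicate k false ++_)
    (tail α o (last x σ′) (∈-resp-↭ σ↭ (last∈ x σ′))))
  where
  -- Of the finished block only its last element, generalised to any `y` of the antichain, enters
  -- the comparison.
  tail : ∀ α → Ordered b s t (a ∷ α) → ∀ y → y ∈ interval s (value a) →
         changes b (descents (y ∷ canonical (not b) t (s ℕ.+ value a) α)) ≡ boundary α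
  tail []      o y y∈ = refl
  tail (c ∷ α) o y y∈ = trans
    (changes-junction b s t a c α o y∈ (canonical-Blocks (not b) t (s ℕ.+ value a) (c ∷ α)))
    (cong (true ∷_) (canonical-changes (not b) t (s ℕ.+ value a) (c ∷ α)
                          (Ordered-tail b s t a (c ∷ α) o)))

-- The first block that departs from its direction decides the comparison. Up to there the change
-- words agree, since the changes at junctions are forced. If no block departs, `monotone-unique`
-- identifies each of them.
canonical-or-⊏ : ∀ b s t α {π} → Ordered b s t α → Blocks s t α π →
                 π ≡ canonical b s t α ⊎ word α ⊏ changes b (descents π)
canonical-or-⊏ b s t []      o π≡[] = inj₁ π≡[]
canonical-or-⊏ b s t (a@(1+ k) ∷ α) o (σ , τ , refl , σ↭ , B)
  with x , σ′ , refl , refl ← nonempty σ↭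
  with monotone-or-⊏ b x σ′ τ (boundary α) (length-boundary t (s ℕ.+ value a) α B)
... | inj₂ p = inj₂ p
... | inj₁ m with tail α o (last x σ′) (∈-resp-↭ σ↭ (last∈ x σ′)) B
  where
  tail : ∀ α → Ordered b s t (a ∷ α) → ∀ y → y ∈ interval s (value a) →
         ∀ {τ} → Blocks t (s ℕ.+ value a) α τ →
         τ ≡ canonical (not b) t (s ℕ.+ value a) α ⊎ boundary α ⊏ changes b (descents (y ∷ τ))
  tail []      o y y∈ τ≡[] = inj₁ τ≡[]
  tail (c ∷ α) o y y∈ B
    with canonical-or-⊏ (not b) t (s ℕ.+ value a) (c ∷ α) (Ordered-tail b s t a (c ∷ α) o) B
  ... | inj₁ eq = inj₁ eq
  ... | inj₂ p  = inj₂ (subst (true ∷ word (c ∷ α) ⊏_)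
                    (sym (changes-junction b s t a c α o y∈ B)) (there p))
...   | inj₁ eq = inj₁ (cong₂ _++_ (monotone-unique b m (block-monotone b s (value a))
                    (↭-trans σ↭ (↭-sym (block-↭ b s (value a))))) eq)
...   | inj₂ p  = inj₂ (subst (word (a ∷ α) ⊏_) (sym (changes-monotone b x σ′ τ m))
                    (Lex-++⁺ (replicate k false) p))

-- Unitriangularity and the basis

leadingExtension : Composition → List ℕ
leadingExtension α = canonical false (evenWeight α) 0 α

-- The descent word of `leadingExtension α` for nonempty α, rebuilt from its changes.
leadingWord : Composition → Word
leadingWord α = accumulate false (word α)

accumulate-injective : ∀ {u v} → accumulate false u ≡ accumulate false v → u ≡ v
accumulate-injective {u} {v} e =
  trans (sym (changes-accumulate false u))
        (trans (cong (changes false) e) (changes-accumulate false v))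

linearExtensions⇒Blocks : ∀ α {π} → π ∈ linearExtensions (𝐏 α) → Blocks (evenWeight α) 0 α π
linearExtensions⇒Blocks α π∈ =
  linearExtension⇒Blocks (evenWeight α) 0 α (antichains-⟂ (evenWeight α) 0 α (inj₁ ℕₚ.≤-refl))
    (linearExtensions⁻ (𝐏 α) π∈)

leadingExtension∈ : ∀ α → leadingExtension α ∈ linearExtensions (𝐏 α)
leadingExtension∈ α = linearExtensions⁺ (𝐏 α)
  (Blocks⇒linearExtension (evenWeight α) 0 α (antichains-⟂ (evenWeight α) 0 α (inj₁ ℕₚ.≤-refl))
    (canonical-Blocks false (evenWeight α) 0 α))

C-Blocks : ∀ s t a α {π} → Blocks s t (a ∷ α) π →
           C π ≡ composition (accumulate false (changes false (descents π)))
C-Blocks s t a α (σ , τ , refl , σ↭ , _) with x , σ′ , refl , _ ← nonempty σ↭ =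
  trans (C-descents x (σ′ ++ τ)) (cong composition (sym (accumulate-changes false _)))

C-leadingExtension : ∀ a α → C (leadingExtension (a ∷ α)) ≡ composition (leadingWord (a ∷ α))
C-leadingExtension a α = trans
  (C-Blocks (evenWeight (a ∷ α)) 0 a α (canonical-Blocks false (evenWeight (a ∷ α)) 0 (a ∷ α)))
  (cong (composition ∘ accumulate false) (canonical-changes false _ 0 (a ∷ α) ℕₚ.≤-refl))

-- Together with `C-leadingExtension` and the distinctness of the linear extensions, this is the
-- unitriangularity of N over L.
C-linearExtension : ∀ a α {π} → π ∈ linearExtensions (𝐏 (a ∷ α)) → π ≢ leadingExtension (a ∷ α) →
                    ∃ λ v → word (a ∷ α) ⊏ v × C π ≡ composition (accumulate false v)
C-linearExtension a α {π} π∈ π≢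
  with B ← linearExtensions⇒Blocks (a ∷ α) π∈
  with canonical-or-⊏ false _ 0 (a ∷ α) ℕₚ.≤-refl B
... | inj₁ eq = ⊥-elim (π≢ eq)
... | inj₂ p  = changes false (descents π) , p , C-Blocks (evenWeight (a ∷ α)) 0 a α B

-- `Spanning` lets an index occur repeatedly, so combinations are added by concatenation.
span : ∀ {I : Set} → (I → QSym) → Submodule
span b = record
  { Contains = λ f → ∃ λ ts → f ≈ linearCombination QSym-module b ts
  ; resp     = λ f≈g (ts , f≈) → ts , λ α i → trans (sym (f≈g α i)) (f≈ α i)
  ; 𝟎-closed = [] , λ _ _ → refl
  ; ⊞-closed = λ (ts , f≈) (us , g≈) → ts ++ us , λ α i →
      trans (cong₂ ℤ._+_ (f≈ α i) (g≈ α i)) (sym (++-homo ts us α i))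
  ; ·-closed = λ c (ts , f≈) → map (λ (d , j) → c ℤ.* d , j) ts , λ α i →
      trans (cong (c ℤ.*_) (f≈ α i)) (sym (scale-homo c ts α i))
  }
  where
  ++-homo : ∀ ts us → linearCombination QSym-module b (ts ++ us) ≈
                      linearCombination QSym-module b ts ⊞ linearCombination QSym-module b us
  ++-homo []             us α i = sym (ℤₚ.+-identityˡ _)
  ++-homo ((c , j) ∷ ts) us α i =
    trans (cong (λ z → c ℤ.* coefficient (b j) α i ℤ.+ z) (++-homo ts us α i))
          (sym (ℤₚ.+-assoc (c ℤ.* coefficient (b j) α i) _ _))
  scale-homo : ∀ c ts → linearCombination QSym-module b (map (λ (d , j) → c ℤ.* d , j) ts) ≈
                        c · linearCombination QSym-module b ts
  scale-homo c []             α i = sym (ℤₚ.*-zeroʳ c)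
  scale-homo c ((d , j) ∷ ts) α i =
    trans (cong₂ ℤ._+_ (ℤₚ.*-assoc c d _) (scale-homo c ts α i))
          (sym (ℤₚ.*-distribˡ-+ c (d ℤ.* coefficient (b j) α i) _))

∈-span : ∀ {I : Set} (b : I → QSym) j → Submodule.Contains (span b) (b j)
∈-span b j = (1ℤ , j) ∷ [] , λ α i →
  sym (trans (ℤₚ.+-identityʳ _) (ℤₚ.*-identityˡ (coefficient (b j) α i)))

module _ (S : Submodule) (N∈S : ∀ α → Submodule.Contains S (N α)) where
  open Submodule S

  -- Induction towards larger words: this L is the leading term of `N (composition v)`, and all
  -- other terms belong to larger words.
  L∈ : ∀ v → Contains (L (composition (accumulate false v)))
  L∈ v = go v (⊐-wellFounded v)
    where
    go : ∀ v → Acc (flip _⊏_) v → Contains (L (composition (accumulate false v)))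
    go v (acc rec) = subst (Contains ∘ L)
      (trans (C-leadingExtension (1+ first v) (rest v))
             (cong (composition ∘ accumulate false) (word-composition v)))
      (∑-extract (L ∘ C) id (leadingExtension∈ (composition v))
        (linearExtensions-unique (𝐏 (composition v))) others (N∈S (composition v)))
      where
      others : ∀ {π} → π ∈ linearExtensions (𝐏 (composition v)) →
               π ≢ leadingExtension (composition v) → Contains (L (C π))
      others π∈ π≢ with u , v⊏u , eq ← C-linearExtension (1+ first v) (rest v) π∈ π≢ =
        subst (Contains ∘ L) (sym eq) (go u (rec (subst (_⊏ u) (word-composition v) v⊏u)))

  -- The same induction one level down: 𝐱^α is the leading term of L_α, and the other terms are its
  -- strict refinements.
  𝐱∈ : ∀ α → Contains (𝐱^ α)
  𝐱∈ []      = N∈S []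
  𝐱∈ (a ∷ α) = subst (Contains ∘ 𝐱^_) (composition-word a α) (go _ (⊐-wellFounded _))
    where
    go : ∀ v → Acc (flip _⊏_) v → Contains (𝐱^ composition v)
    go v (acc rec) = ∑-extract 𝐱^_ id (∈-refinements⁺ (≼-refl {composition v}))
      (refinements-unique (composition v)) (λ β∈ → others (∈-refinements⁻ β∈))
      -- Every L of a nonempty composition has the form treated by `L∈`, since `accumulate` inverts
      -- `changes`.
      (subst (Contains ∘ L ∘ composition) (accumulate-changes false v) (L∈ (changes false v)))
      where
      others : ∀ {β} → β ≼ composition v → β ≢ composition v → Contains (𝐱^ β)
      others {[]}    ([]≡ , _) _  = N∈S []
      others {b ∷ β} β≼ β≢ = subst (Contains ∘ 𝐱^_) (composition-word b β)
        (go u (rec (⊴∧≢⇒⊏ (≼⇒⊴ (subst (_≼ composition v) (sym (composition-word b β)) β≼))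
          λ v≡u → β≢ (trans (sym (composition-word b β)) (cong composition (sym v≡u))))))
        where u = word (b ∷ β)

-- The L-coordinate at the leading term of N_α. The empty composition is no `composition w`, so the
-- constant coefficient takes its place.
dual : Composition → Functional
dual []          = coefficientOf []
dual α@(_ ∷ _) = L-coordinate (leadingWord α)

dual-self : ∀ α → apply (dual α) (N α) ≡ 1ℤ
dual-self []          = refl
dual-self α@(a ∷ α′) = trans
  (Functional.∑-single (dual α) (L ∘ C) id (leadingExtension∈ α)
    (linearExtensions-unique (𝐏 α)) others)
  (trans (cong (apply (dual α) ∘ L) (C-leadingExtension a α′)) (L-coordinate-self (leadingWord α)))
  where
  others : ∀ {π} → π ∈ linearExtensions (𝐏 α) → π ≢ leadingExtension α →
           apply (dual α) (L (C π)) ≡ 0ℤ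
  others π∈ π≢ with v , α⊏v , eq ← C-linearExtension a α′ π∈ π≢ =
    trans (cong (apply (dual α) ∘ L) eq)
      (L-coordinate-other _ _ λ e →
        Lex-irrefl (λ ()) (subst (word α ⊏_) (accumulate-injective e) α⊏v))

-- For nonempty α and β, the change words occurring in N_β are `word β` and larger ones, so that of
-- the leading term of N_α is not among them. When one of them is empty, the weights differ.
dual-other : ∀ α β → β ≢ α → ¬ word β ⊏ word α → apply (dual α) (N β) ≡ 0ℤ
dual-other []          []          β≢α _ = ⊥-elim (β≢α refl)
dual-other (a ∷ α)     []          _ _ =
  möbius-zero 𝟏 composition (leadingWord (a ∷ α)) λ u →
    𝐱-coefficient-other [] (composition u) (firstVariables (length (composition u))) λ ()
dual-other []          β@(b ∷ β′) _ _ =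
  Functional.∑-vanish (dual []) (L ∘ C) (linearExtensions (𝐏 β)) λ {π} π∈ →
    L-coefficient-⋠ (C π) [] _ λ ([]≡ , _) → positive π∈ []≡
  where
  positive : ∀ {π} → π ∈ linearExtensions (𝐏 β) → 0 ≢ weight (C π)
  positive {π} π∈ 0≡ 
    with () ← trans 0≡ (cong weight
      (C-Blocks (evenWeight β) 0 b β′ (linearExtensions⇒Blocks β π∈)))
dual-other α@(a ∷ α′) β@(b ∷ β′) β≢α β⋢α =
  Functional.∑-vanish (dual α) (L ∘ C) (linearExtensions (𝐏 β)) vanish
  where
  vanish-at : ∀ v {γ} → γ ≡ composition (accumulate false v) → v ≢ word α → 
              apply (dual α) (L γ) ≡ 0ℤ
  vanish-at v refl v≢ =
    L-coordinate-other (accumulate false v) (leadingWord α) (v≢ ∘ accumulate-injective)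
  vanish : ∀ {π} → π ∈ linearExtensions (𝐏 β) → apply (dual α) (L (C π)) ≡ 0ℤ
  vanish {π} π∈ with ≡-dec ℕₚ._≟_ π (leadingExtension β)
  ... | yes refl = vanish-at (word β) (C-leadingExtension b β′)
    λ e → β≢α (trans (sym (composition-word b β′))
                     (trans (cong composition e) (composition-word a α′)))
  ... | no π≢ with v , β⊏v , eq ← C-linearExtension b β′ π∈ π≢ =
    vanish-at v eq λ { refl → β⋢α β⊏v }

-- Induction towards smaller words. Under `dual α` the terms with smaller words vanish because their
-- coefficients are already 0, the remaining ones by `dual-other`, and only the coefficient at α
-- survives.
N-linearlyIndependent : LinearlyIndependent QSym-module N
N-linearlyIndependent ts unique ≈0 = All.tabulate λ {(_ , α)} t∈ →
  go α (On.wellFounded word ⊏-wellFounded α) t∈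
  where
  term : ℤ × Composition → QSym
  term (c , α) = c · N α

  sum≈0 : ∑ (map term ts) ≈ 𝟎
  sum≈0 α i = trans (cong (λ f → coefficient f α i) (foldr-map _⊞_ term 𝟎 ts)) (≈0 α i)

  go : ∀ α → Acc (_⊏_ on word) α → ∀ {c} → (c , α) ∈ ts → c ≡ 0ℤ
  go α (acc rec) {c} t∈ =
    trans (sym value-c) (trans (Functional.≈-cong (dual α) sum≈0) (Functional.𝟎-homo (dual α)))
    where
    others : ∀ {u} → u ∈ ts → proj₂ u ≢ α → apply (dual α) (term u) ≡ 0ℤ
    others {d , β} u∈ β≢α with word β ⊏? word α
    ... | yes β⊏α = trans (Functional.·-homo (dual α) d (N β)) (cong (ℤ._* _) (go β (rec β⊏α) u∈))
    ... | no β⋢α  = trans (Functional.·-homo (dual α) d (N β))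
                      (trans (cong (d ℤ.*_) (dual-other α β β≢α β⋢α)) (ℤₚ.*-zeroʳ d))
    value-c : apply (dual α) (∑ (map term ts)) ≡ c
    value-c = trans (Functional.∑-single (dual α) term proj₂ t∈ (AllPairsₚ.map⁻ unique) others)
      (trans (Functional.·-homo (dual α) c (N α))
        (trans (cong (c ℤ.*_) (dual-self α)) (ℤₚ.*-identityʳ c)))

theorem3p4 : IsBasis QSym-module N
theorem3p4 = record
  { spanning            = monomials⊆⇒all (span N) (𝐱∈ (span N) (∈-span N))
  ; linearlyIndependent = N-linearlyIndependent
  }
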